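{- Let $\mathbb F$ be a field, $n\ge2$, and suppose $\mathcal C$ is an $\{n,\frac{n(n+1)}{2}-4,4\}_{\mathbb F}$ code. Then there exists a cap of cardinality $n$ in $\mathrm{PG}(3,\mathbb F)$, i.e. a set of $n$ points no three of which are collinear. In particular, $n\le 8$ if $|\mathbb F|=2$, and $n\le|\mathbb F|^2+1$ if $\mathbb F$ is finite with $|\mathbb F|>2$.
   Context: $\mathrm{U}(n,\mathbb F)$ is the space of $n\times n$ upper triangular matrices over $\mathbb F$. For $M\in\mathrm{U}(n,\mathbb F)$, $M_{[i]}$ is the submatrix with rows $1,\dots,i$ and columns $i,\dots,n$, and $\mathrm{w}_{\mathrm{fr}}(M)=\sum_{i=1}^n\operatorname{rk}(M_{[i]})$. An $\{n,t,\delta\}_{\mathbb F}$ code is an $\mathbb F$-linear subspace of $\mathrm{U}(n,\mathbb F)$ of dimension $t$ whose minimum $\mathrm{w}_{\mathrm{fr}}$ over nonzero elements is $\delta$. $\mathrm{PG}(3,\mathbb F)$ is the projective space of $\mathbb F^4$. -}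

module Defs where

open import Level using (Level; _⊔_)
open import Algebra.Bundles using (CommutativeRing)
open import Data.Nat as ℕ using (ℕ; zero; suc; _≤_; _<_)
open import Data.Fin as Fin using (Fin; toℕ)
open import Data.Product using (Σ; ∃; _×_; _,_)
open import Relation.Nullary using (¬_)
open import Relation.Binary.PropositionalEquality using (_≡_)

record Field (c ℓ : Level) : Set (Level.suc (c ⊔ ℓ)) where
  field
    commutativeRing : CommutativeRing c ℓ
  open CommutativeRing commutativeRing public
  field
    0≉1     : ¬ (0# ≈ 1#)
    inverse : ∀ x → ¬ (x ≈ 0#) → ∃ λ y → (x * y) ≈ 1#

sumℕ : ∀ {n} → (Fin n → ℕ) → ℕ
sumℕ {zero}  f = 0
sumℕ {suc n} f = f Fin.zero ℕ.+ sumℕ (λ i → f (Fin.suc i))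

module LinearAlgebra {c ℓ} (F : Field c ℓ) where
  open Field F

  Σ[_] : ∀ {n} → (Fin n → Carrier) → Carrier
  Σ[_] {zero}  f = 0#
  Σ[_] {suc n} f = f Fin.zero + Σ[ (λ i → f (Fin.suc i)) ]

  Vector : ℕ → Set c
  Vector m = Fin m → Carrier

  LinIndep : ∀ {k m} → (Fin k → Vector m) → Set (c ⊔ ℓ)
  LinIndep {k} {m} v =
    (a : Fin k → Carrier) →
    (∀ j → Σ[ (λ i → a i * v i j) ] ≈ 0#) →
    ∀ i → a i ≈ 0#

  Mat : ℕ → Set c
  Mat n = Fin n → Fin n → Carrier

  _≋_ : ∀ {n} → Mat n → Mat n → Set ℓ
  M ≋ N = ∀ i j → M i j ≈ N i j

  0M : ∀ {n} → Mat n
  0M i j = 0#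

  _+M_ : ∀ {n} → Mat n → Mat n → Mat n
  (M +M N) i j = M i j + N i j

  _·M_ : ∀ {n} → Carrier → Mat n → Mat n
  (a ·M M) i j = a * M i j

  UpperTriangular : ∀ {n} → Mat n → Set ℓ
  UpperTriangular M = ∀ i j → toℕ j < toℕ i → M i j ≈ 0#

  NonZeroMat : ∀ {n} → Mat n → Set ℓ
  NonZeroMat M = ¬ (M ≋ 0M)

  -- rank of M_[i] (rows 1..i, columns i..n in 1-based indexing; with
  -- 0-based i : Fin n this is rows 0..i and columns i..n-1).
  -- "M_[i] has r linearly independent rows": there are r row indices
  -- (all ≤ i) whose rows, restricted to the columns ≥ i, are independent.
  IndepRowsSub : ∀ {n} → Mat n → Fin n → ℕ → Set (c ⊔ ℓ)
  IndepRowsSub {n} M i r =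
    Σ (Fin r → Fin n) λ σ →
      (∀ k → toℕ (σ k) ≤ toℕ i) ×
      ((a : Fin r → Carrier) →
       (∀ j → toℕ i ≤ toℕ j → Σ[ (λ k → a k * M (σ k) j) ] ≈ 0#) →
       ∀ k → a k ≈ 0#)

  RankSub : ∀ {n} → Mat n → Fin n → ℕ → Set (c ⊔ ℓ)
  RankSub M i r = IndepRowsSub M i r × ¬ IndepRowsSub M i (suc r)

  WeightFr : ∀ {n} → Mat n → ℕ → Set (c ⊔ ℓ)
  WeightFr {n} M w =
    Σ (Fin n → ℕ) λ r → (∀ i → RankSub M i (r i)) × (sumℕ r ≡ w)

  record IsSubspaceU {p} (n t : ℕ) (C : Mat n → Set p) : Set (c ⊔ ℓ ⊔ p) where
    field
      upper   : ∀ M → C M → UpperTriangular M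
      respect : ∀ M N → M ≋ N → C M → C N
      zero∈   : C 0M
      +-closed : ∀ M N → C M → C N → C (M +M N)
      ·-closed : ∀ a M → C M → C (a ·M M)
      basis        : Fin t → Mat n
      basis∈       : ∀ k → C (basis k)
      basis-indep  : (a : Fin t → Carrier) →
                     (∀ i j → Σ[ (λ k → a k * basis k i j) ] ≈ 0#) →
                     ∀ k → a k ≈ 0#
      basis-span   : ∀ M → C M →
                     ∃ λ (a : Fin t → Carrier) →
                       ∀ i j → M i j ≈ Σ[ (λ k → a k * basis k i j) ]

  MinDistance : ∀ {p} {n} → (Mat n → Set p) → ℕ → Set (c ⊔ ℓ ⊔ p)
  MinDistance {n = n} C δ =
    (∀ M → C M → NonZeroMat M → ∀ w → WeightFr M w → δ ≤ w) ×
    (∃ λ M → C M × NonZeroMat M × WeightFr M δ)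

  record Code {p} (n t δ : ℕ) (C : Mat n → Set p) : Set (c ⊔ ℓ ⊔ p) where
    field
      subspace : IsSubspaceU n t C
      distance : MinDistance C δ

  -- PG(3,F): points are 1-dimensional subspaces of F^4, represented by
  -- nonzero vectors; distinct points = linearly independent representatives;
  -- three distinct points are collinear iff their representatives are
  -- linearly dependent.
  pair : ∀ {m} → Vector m → Vector m → Fin 2 → Vector m
  pair u v Fin.zero = u
  pair u v (Fin.suc _) = v

  triple : ∀ {m} → Vector m → Vector m → Vector m → Fin 3 → Vector m
  triple u v w Fin.zero = u
  triple u v w (Fin.suc Fin.zero) = v
  triple u v w (Fin.suc (Fin.suc _)) = w

  Cap : ℕ → Set (c ⊔ ℓ)
  Cap n =
    Σ (Fin n → Vector 4) λ P →
      (∀ i → ¬ (∀ j → P i j ≈ 0#)) ×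
      (∀ i j → ¬ (i ≡ j) → LinIndep (pair (P i) (P j))) ×
      (∀ i j k → ¬ (i ≡ j) → ¬ (j ≡ k) → ¬ (i ≡ k) →
         LinIndep (triple (P i) (P j) (P k)))

  HasCardinality : ℕ → Set (c ⊔ ℓ)
  HasCardinality q =
    Σ (Fin q → Carrier) λ e →
      (∀ i j → e i ≈ e j → i ≡ j) × (∀ x → ∃ λ i → e i ≈ x)

{-# OPTIONS --safe #-}
module Submission where

-- The matrices in the span W of E₁₁, E₁₂, E₂₂, E₃₃ have weight at most 3, so W is
-- a complement of the code, and the projection onto W along the code sends the
-- diagonal units E_ii to n vectors of F⁴. Diagonal matrices with at most three
-- nonzero entries have weight at most 3, so these vectors form a cap.
-- Equality in F is not assumed decidable, so minimum distance only gives double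
-- negations. Two devices recover constructive conclusions: determinants, for the
-- projection, and a binary form N without nontrivial zeros, read off the code on
-- the first 3 × 3 block, which makes "not all zero" yield an invertible element.
--
-- For |F| = 2 the bound counts lines through a point of the cap. For |F| = q > 2,
-- a cap of more than q² + 1 points has each of its secants in a plane meeting it
-- in q + 2 points, which forces q to be even; as long as the cap has a tangent, the
-- nucleus of an oval plane section enlarges it. A cap without tangents has
-- q² + q + 2 points, and the planes through an external line meet it in 0 or q + 2
-- points, so q + 2 divides 4.

open import Defs
open import Level using (_⊔_)
open import Algebra.Bundles using (CommutativeRing)
open import Data.Empty using (⊥)
open import Data.Fin as Fin using (Fin; zero; suc; toℕ; punchIn; punchOut)
open import Data.Fin.Permutation using (permutation)
open import Data.Fin.Properties as Fin using ()
open import Data.List as List using (List; []; _∷_; _++_; length; allFin)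
open import Data.List.Membership.Propositional using (_∈_)
open import Data.List.Membership.Propositional.Properties using (∈-∃++; ∈-++⁺ˡ; ∈-++⁺ʳ; ∈-map⁺; ∈-allFin)
import Data.List.Membership.DecPropositional as DecMembership
open import Data.List.Properties using (length-++; length-map; length-tabulate)
open import Data.List.Relation.Binary.Permutation.Propositional as ↭ using (_↭_; ↭-sym; ↭-trans)
open import Data.List.Relation.Binary.Permutation.Propositional.Properties using (shift; ∈-resp-↭; ↭-length)
open import Data.List.Relation.Unary.All as All using (All; []; _∷_)
open import Data.List.Relation.Unary.AllPairs using ([]; _∷_)
open import Data.List.Relation.Unary.Any using (here; there)
open import Data.List.Relation.Unary.Unique.Propositional using (Unique)
open import Data.Nat as ℕ using (ℕ; zero; suc; _≤_; _<_; z≤n; s≤s)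
open import Data.Nat.Divisibility using (_∣_; _∣0; ∣-refl; ∣m∣n⇒∣m+n; ∣m+n∣m⇒∣n; ∣⇒≤; m∣m*n)
open import Data.Nat.Properties as ℕ using ()
open import Data.Product using (Σ; _×_; ∃; ∃₂; _,_; proj₁; proj₂; uncurry)
open import Data.Product.Properties using (≡-dec)
open import Data.Sum using (_⊎_; inj₁; inj₂; [_,_])
open import Data.Unit using (⊤; tt)
open import Data.Vec.Functional as VF using ()
open import Data.Vec.Functional.Properties using (insertAt-lookup; insertAt-punchIn)
open import Function using (_∘_; id; case_of_)
open import Function.Definitions using (Injective)
open import Relation.Binary.Definitions using (DecidableEquality)
open import Relation.Binary.PropositionalEquality as ≡ using (_≡_; _≢_)
open import Relation.Nullary using (¬_; Dec; yes; no; contradiction)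
open import Relation.Nullary.Decidable using (map′; decidable-stable; ¬?; _×-dec_)

-- On W the first three blocks `M_[1]`, `M_[2]`, `M_[3]` are each supported in one row or one column
-- and the later blocks vanish, whence weight at most 3. As the code has codimension 4, a complement
-- of this kind is what produces vectors of `F^4`.
--
-- Restriction of the code to the positions outside W is injective only up to double negation, while
-- solving a linear system needs an actual inverse. A determinant is a single field element, and
-- being nonzero is itself a negation, so the weak form of injectivity is enough to invert it.
-- Independence of the cap vectors calls instead for a pivot, and in a vector that is not zero no
-- entry can be singled out as nonzero. The form N folds the entries into one linear combination of
-- them that vanishes only if all do. It has no nontrivial zero because such a zero would be a
-- nonzero codeword of weight at most 3.
--
-- In the geometry, q > 2 is what contradicts the last divisibility: q^2 + q + 2 = (q - 1)(q + 2) +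
-- 4.

module ℤ-Coefficients {c ℓ} (R : CommutativeRing c ℓ) where
  open CommutativeRing R hiding (zero)
  open import Algebra.Properties.Ring ring
  open import Algebra.Properties.Semiring.Mult.TCOptimised semiring renaming (_×_ to _·_)
  open import Algebra.Solver.Ring.AlmostCommutativeRing
  open import Relation.Binary.Reasoning.Setoid setoid
  open import Data.Integer as ℤ using (ℤ; -[1+_])
  open import Data.Integer.Properties as ℤ using ()
  open import Data.Maybe using (Maybe; just; nothing)
  import Algebra.Solver.Ring as RingSolver

  private
    ⟦_⟧ᶻ : ℤ → Carrier
    ⟦ ℤ.+ n ⟧ᶻ = n · 1#
    ⟦ -[1+ n ] ⟧ᶻ = - (ℕ.suc n · 1#)

    cancel : ∀ x y z → (x + y) + - (x + z) ≈ y + - z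
    cancel x y z = begin
      (x + y) + - (x + z)     ≈⟨ +-cong (+-comm x y) (sym (-‿+-comm x z)) ⟩
      (y + x) + (- x + - z)   ≈⟨ +-assoc y x _ ⟩
      y + (x + (- x + - z))   ≈⟨ +-congˡ (sym (+-assoc x (- x) (- z))) ⟩
      y + ((x + - x) + - z)   ≈⟨ +-congˡ (trans (+-congʳ (-‿inverseʳ x)) (+-identityˡ _)) ⟩
      y + - z                 ∎

    ⊖-homo : ∀ m n → ⟦ m ℤ.⊖ n ⟧ᶻ ≈ m · 1# + - (n · 1#)
    ⊖-homo m ℕ.zero = begin
      m · 1#          ≈⟨ sym (+-identityʳ _) ⟩
      m · 1# + 0#     ≈⟨ +-congˡ (sym -0#≈0#) ⟩
      m · 1# + - 0#   ∎
    ⊖-homo ℕ.zero (ℕ.suc n) = sym (+-identityˡ _)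
    ⊖-homo (ℕ.suc m) (ℕ.suc n) = begin
      ⟦ ℕ.suc m ℤ.⊖ ℕ.suc n ⟧ᶻ              ≡⟨ ≡.cong ⟦_⟧ᶻ (ℤ.[1+m]⊖[1+n]≡m⊖n m n) ⟩
      ⟦ m ℤ.⊖ n ⟧ᶻ                          ≈⟨ ⊖-homo m n ⟩
      m · 1# + - (n · 1#)                   ≈⟨ sym (cancel 1# _ _) ⟩
      (1# + m · 1#) + - (1# + n · 1#)       ≈⟨ +-cong (sym (1+× m 1#)) (-‿cong (sym (1+× n 1#))) ⟩
      ℕ.suc m · 1# + - (ℕ.suc n · 1#)       ∎

    +-homoᶻ : ∀ i j → ⟦ i ℤ.+ j ⟧ᶻ ≈ ⟦ i ⟧ᶻ + ⟦ j ⟧ᶻ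
    +-homoᶻ (ℤ.+ m) (ℤ.+ n) = ×-homo-+ 1# m n
    +-homoᶻ (ℤ.+ m) -[1+ n ] = ⊖-homo m (ℕ.suc n)
    +-homoᶻ -[1+ m ] (ℤ.+ n) = trans (⊖-homo n (ℕ.suc m)) (+-comm _ _)
    +-homoᶻ -[1+ m ] -[1+ n ] = trans
      (-‿cong (trans (1+× (ℕ.suc (m ℕ.+ n)) 1#)
        (trans (+-congˡ (×-homo-+ 1# (ℕ.suc m) n))
        (trans (sym (+-assoc _ _ _)) (trans (+-congʳ (+-comm _ _)) (trans (+-assoc _ _ _) (+-congˡ (sym (1+× n 1#)))))))))
      (sym (-‿+-comm _ _))

    -◃-homo : ∀ n → ⟦ ℤ.- (ℤ.+ n) ⟧ᶻ ≈ - (n · 1#)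
    -◃-homo ℕ.zero = sym -0#≈0#
    -◃-homo (ℕ.suc n) = refl

    *-homoᶻ : ∀ i j → ⟦ i ℤ.* j ⟧ᶻ ≈ ⟦ i ⟧ᶻ * ⟦ j ⟧ᶻ
    *-homoᶻ (ℤ.+ m) (ℤ.+ n) =
      trans (reflexive (≡.cong ⟦_⟧ᶻ (ℤ.+◃n≡+n (m ℕ.* n)))) (×1-homo-* m n)
    *-homoᶻ (ℤ.+ m) -[1+ n ] =
      trans (reflexive (≡.cong ⟦_⟧ᶻ (ℤ.-◃n≡-n (m ℕ.* ℕ.suc n))))
      (trans (-◃-homo (m ℕ.* ℕ.suc n)) (trans (-‿cong (×1-homo-* m (ℕ.suc n))) (-‿distribʳ-* _ _)))
    *-homoᶻ -[1+ m ] (ℤ.+ n) =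
      trans (reflexive (≡.cong ⟦_⟧ᶻ (ℤ.-◃n≡-n (ℕ.suc m ℕ.* n))))
      (trans (-◃-homo (ℕ.suc m ℕ.* n)) (trans (-‿cong (×1-homo-* (ℕ.suc m) n)) (-‿distribˡ-* _ _)))
    *-homoᶻ -[1+ m ] -[1+ n ] = begin
      (ℕ.suc m ℕ.* ℕ.suc n) · 1#               ≈⟨ ×1-homo-* (ℕ.suc m) (ℕ.suc n) ⟩
      ℕ.suc m · 1# * ℕ.suc n · 1#              ≈⟨ sym (-‿involutive _) ⟩
      - (- (ℕ.suc m · 1# * ℕ.suc n · 1#))      ≈⟨ -‿cong (-‿distribˡ-* _ _) ⟩
      - (- (ℕ.suc m · 1#) * ℕ.suc n · 1#)      ≈⟨ -‿distribʳ-* _ _ ⟩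
      - (ℕ.suc m · 1#) * - (ℕ.suc n · 1#)      ∎

    -‿homoᶻ : ∀ i → ⟦ ℤ.- i ⟧ᶻ ≈ - ⟦ i ⟧ᶻ
    -‿homoᶻ (ℤ.+ n) = -◃-homo n
    -‿homoᶻ -[1+ n ] = sym (-‿involutive _)

    _≟ᶻ_ : ∀ i j → Maybe (⟦ i ⟧ᶻ ≈ ⟦ j ⟧ᶻ)
    i ≟ᶻ j with i ℤ.≟ j
    ... | yes i≡j = just (reflexive (≡.cong ⟦_⟧ᶻ i≡j))
    ... | no _ = nothing

    -- Coefficients are integers because the solver has to decide their equality, which the carrier
    -- of `R` does not allow; cancellation of opposite terms depends on it.
    homomorphism : ℤ.+-*-rawRing -Raw-AlmostCommutative⟶ fromCommutativeRing R
    homomorphism = record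
      { ⟦_⟧ = ⟦_⟧ᶻ ; +-homo = +-homoᶻ ; *-homo = *-homoᶻ ; -‿homo = -‿homoᶻ ; 0-homo = refl ; 1-homo = refl }

  open RingSolver ℤ.+-*-rawRing (fromCommutativeRing R) homomorphism _≟ᶻ_ public

  :0 :1 : ∀ {n} → Polynomial n
  :0 = con (ℤ.+ 0)
  :1 = con (ℤ.+ 1)

import Data.List.Membership.DecPropositional as DecMembership
open import Data.Vec.Functional as VF using ()
open import Function using (_∘_; id)
open import Relation.Binary.Definitions using (DecidableEquality)
open import Relation.Nullary using (¬_; yes; no; contradiction)
open import Relation.Binary.PropositionalEquality as ≡ using (_≡_)

-- Double negation over finite families, and lists without repetition.

¬¬-∀ : ∀ {p n} {P : Fin n → Set p} → (∀ i → ¬ ¬ P i) → ¬ ¬ (∀ i → P i)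
¬¬-∀ {n = zero} h k = k λ ()
¬¬-∀ {n = suc n} h k = h zero λ p₀ → ¬¬-∀ (h ∘ suc) λ ps → k λ { zero → p₀ ; (suc i) → ps i }

¬¬-All : ∀ {a p} {A : Set a} {P : A → Set p} (xs : List A) → (∀ {x} → x ∈ xs → ¬ ¬ P x) → ¬ ¬ All P xs
¬¬-All [] h k = k []
¬¬-All (x ∷ xs) h k = h (here ≡.refl) λ p → ¬¬-All xs (h ∘ there) λ ps → k (p ∷ ps)

-- The head of `xs` does not recur, so removing it from `ys` preserves the inclusion of the tails;
-- equal lengths leave nothing over at the end.
Unique-⊆-↭ : ∀ {a} {A : Set a} {xs ys : List A} → Unique xs → (∀ {x} → x ∈ xs → x ∈ ys) →
             length xs ≡ length ys → xs ↭ ys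
Unique-⊆-↭ {xs = []} {[]} _ _ _ = ↭.refl
Unique-⊆-↭ {xs = x ∷ xs} {ys} (x∉xs ∷ xs!) xs⊆ys |xs|≡|ys| with ∈-∃++ (xs⊆ys (here ≡.refl))
... | us , vs , ≡.refl = ↭-trans (↭.prep x (Unique-⊆-↭ xs! sub len)) (↭-sym perm)
  where
  perm : us ++ x ∷ vs ↭ x ∷ us ++ vs
  perm = shift x us vs
  sub : ∀ {y} → y ∈ xs → y ∈ us ++ vs
  sub y∈xs with ∈-resp-↭ perm (xs⊆ys (there y∈xs))
  ... | here ≡.refl = contradiction ≡.refl (All.lookup x∉xs y∈xs)
  ... | there y∈ = y∈
  len : length xs ≡ length (us ++ vs)
  len = ≡.cong ℕ.pred (≡.trans |xs|≡|ys| (↭-length perm))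

-- Linear algebra without decidable equality: sums, minors, Cramer's rule.

module FiniteSums {c ℓ} (F : Field c ℓ) where
  open Field F hiding (zero)
  open LinearAlgebra F
  open ℤ-Coefficients commutativeRing

  Σ-cong : ∀ {n} {f g : Fin n → Carrier} → (∀ i → f i ≈ g i) → Σ[ f ] ≈ Σ[ g ]
  Σ-cong {zero} h = refl
  Σ-cong {suc n} h = +-cong (h zero) (Σ-cong (h ∘ suc))

  Σ-zero : ∀ {n} {f : Fin n → Carrier} → (∀ i → f i ≈ 0#) → Σ[ f ] ≈ 0#
  Σ-zero {zero} h = refl
  Σ-zero {suc n} h = trans (+-cong (h zero) (Σ-zero (h ∘ suc))) (+-identityˡ 0#)

  Σ-+ : ∀ {n} (f g : Fin n → Carrier) → Σ[ (λ i → f i + g i) ] ≈ Σ[ f ] + Σ[ g ]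
  Σ-+ {zero} f g = sym (+-identityˡ 0#)
  Σ-+ {suc n} f g = trans (+-congˡ (Σ-+ (f ∘ suc) (g ∘ suc)))
    (solve 4 (λ a b s t → (a :+ b) :+ (s :+ t) := (a :+ s) :+ (b :+ t)) refl _ _ _ _)

  Σ-* : ∀ {n} a (f : Fin n → Carrier) → Σ[ (λ i → a * f i) ] ≈ a * Σ[ f ]
  Σ-* {zero} a f = sym (zeroʳ a)
  Σ-* {suc n} a f = trans (+-congˡ (Σ-* a (f ∘ suc))) (sym (distribˡ a _ _))

  Σ-linear : ∀ {n} a b (f g : Fin n → Carrier) →
             Σ[ (λ i → a * f i + b * g i) ] ≈ a * Σ[ f ] + b * Σ[ g ]
  Σ-linear a b f g = trans (Σ-+ (λ i → a * f i) (λ i → b * g i)) (+-cong (Σ-* a f) (Σ-* b g))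

  Σ-swap : ∀ {m n} (f : Fin m → Fin n → Carrier) →
           Σ[ (λ i → Σ[ f i ]) ] ≈ Σ[ (λ j → Σ[ (λ i → f i j) ]) ]
  Σ-swap {zero} {n} f = sym (Σ-zero {n} λ _ → refl)
  Σ-swap {suc m} f = trans (+-congˡ (Σ-swap (f ∘ suc))) (sym (Σ-+ (f zero) (λ j → Σ[ (λ i → f (suc i) j) ])))

  Σ-single : ∀ {n} {f : Fin n → Carrier} j → (∀ i → ¬ i ≡ j → f i ≈ 0#) → Σ[ f ] ≈ f j
  Σ-single zero h = trans (+-congˡ (Σ-zero λ i → h (suc i) λ ())) (+-identityʳ _)
  Σ-single (suc j) h = trans (+-cong (h zero λ ()) (Σ-single j λ i i≢j → h (suc i) λ { ≡.refl → i≢j ≡.refl }))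
    (+-identityˡ _)

  a≈0⇒ab≈0 : ∀ {a b} → a ≈ 0# → a * b ≈ 0#
  a≈0⇒ab≈0 a≈0 = trans (*-congʳ a≈0) (zeroˡ _)

  b≈0⇒ab≈0 : ∀ {a b} → b ≈ 0# → a * b ≈ 0#
  b≈0⇒ab≈0 b≈0 = trans (*-congˡ b≈0) (zeroʳ _)

  a-b≈0⇒a≈b : ∀ {a b} → a + - b ≈ 0# → a ≈ b
  a-b≈0⇒a≈b {a} {b} h = trans (solve 2 (λ a b → a := (a :+ :- b) :+ b) refl a b) (trans (+-congʳ h) (+-identityˡ b))

  a≈b⇒a-b≈0 : ∀ {a b} → a ≈ b → a + - b ≈ 0#
  a≈b⇒a-b≈0 {b = b} h = trans (+-congʳ h) (-‿inverseʳ b)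

-- An alternating form on sequences of functions X → F of arbitrary length is
-- built by contracting with the evaluations at points of X; this Laplace
-- expansion makes minors available without decidable equality on the field.
module Minors {c ℓ} (F : Field c ℓ) {x} {X : Set x} where
  open Field F hiding (zero)
  open LinearAlgebra F
  open FiniteSums F
  open ℤ-Coefficients commutativeRing
  open import Relation.Binary.Reasoning.Setoid setoid

  -- The arity is left open so that contracting by a point and inserting a vector stay within one
  -- type. Nothing here makes a form alternating; what is used is antisymmetry in the points, that
  -- is `ι-anticomm` and `ι-square`.
  Form : Set (c ⊔ x)
  Form = ∀ {n} → (Fin n → X → Carrier) → Carrier

  slot : (X → Carrier) → Form → Form
  slot v φ vs = φ (v VF.∷ vs)

  -- Interior product with the evaluation at `x`; the sign alternates with each vector passed.
  ι : X → Form → Form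
  ι x φ {zero} vs = 0#
  ι x φ {suc n} vs = vs zero x * φ (vs ∘ suc) + - ι x (slot (vs zero) φ) (vs ∘ suc)

  -- Zero in positive degree, so that a minor vanishes unless there are as many points as vectors.
  unit : Form
  unit {zero} _ = 1#
  unit {suc _} _ = 0#

  minor : List X → Form
  minor [] = unit
  minor (x ∷ xs) = ι x (minor xs)

  infix 4 _≃_
  _≃_ : Form → Form → Set (c ⊔ ℓ ⊔ x)
  φ ≃ ψ = ∀ {n} (vs : Fin n → X → Carrier) → φ vs ≈ ψ vs

  0Form : Form
  0Form _ = 0#

  ι-cong : ∀ y {φ ψ : Form} → φ ≃ ψ → ι y φ ≃ ι y ψ
  ι-cong y h {zero} vs = refl
  ι-cong y h {suc n} vs = +-cong (*-congˡ (h _)) (-‿cong (ι-cong y (λ us → h (vs zero VF.∷ us)) (vs ∘ suc)))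

  ι-scale : ∀ y a (φ : Form) → ι y (λ us → a * φ us) ≃ (λ us → a * ι y φ us)
  ι-scale y a φ {zero} vs = sym (zeroʳ a)
  ι-scale y a φ {suc n} vs = begin
    v * (a * p) + - ι y (slot (vs zero) (λ us → a * φ us)) ws
      ≈⟨ +-congˡ (-‿cong (ι-scale y a (slot (vs zero) φ) ws)) ⟩
    v * (a * p) + - (a * q)
      ≈⟨ solve 4 (λ v a p q → v :* (a :* p) :+ :- (a :* q) := a :* (v :* p :+ :- q)) refl v a p q ⟩
    a * (v * p + - q) ∎
    where
    ws = vs ∘ suc
    v = vs zero y
    p = φ ws
    q = ι y (slot (vs zero) φ) ws

  ι-0 : ∀ y {φ : Form} → φ ≃ 0Form → ι y φ ≃ 0Form
  ι-0 y {φ} h vs = begin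
    ι y φ vs                  ≈⟨ ι-cong y (λ us → trans (h us) (sym (zeroˡ 0#))) vs ⟩
    ι y (λ _ → 0# * 0#) vs    ≈⟨ ι-scale y 0# 0Form vs ⟩
    0# * ι y 0Form vs         ≈⟨ zeroˡ _ ⟩
    0#                        ∎

  ι-sub : ∀ y (φ ψ : Form) a → ι y (λ us → a * φ us + - ψ us) ≃ (λ us → a * ι y φ us + - ι y ψ us)
  ι-sub y φ ψ a {zero} vs = solve 1 (λ a → :0 := a :* :0 :+ :- :0) refl a
  ι-sub y φ ψ a {suc n} vs = begin
    v * (a * p + - q) + - ι y (slot (vs zero) (λ us → a * φ us + - ψ us)) ws
      ≈⟨ +-congˡ (-‿cong (ι-sub y (slot (vs zero) φ) (slot (vs zero) ψ) a ws)) ⟩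
    v * (a * p + - q) + - (a * r + - s)
      ≈⟨ solve 6 (λ v a p q r s → v :* (a :* p :+ :- q) :+ :- (a :* r :+ :- s)
                  := a :* (v :* p :+ :- r) :+ :- (v :* q :+ :- s)) refl v a p q r s ⟩
    a * (v * p + - r) + - (v * q + - s) ∎
    where
    ws = vs ∘ suc
    v = vs zero y
    p = φ ws
    q = ψ ws
    r = ι y (slot (vs zero) φ) ws
    s = ι y (slot (vs zero) ψ) ws

  -- Unfolding both contractions at the first vector, the mixed terms exchange roles, and what
  -- remains is the same claim for `slot (vs zero) φ` on one vector fewer.
  ι-anticomm : ∀ y z (φ : Form) → ι y (ι z φ) ≃ (λ vs → - ι z (ι y φ) vs)
  ι-anticomm y z φ {zero} vs = sym -0#≈0#
    where open import Algebra.Properties.Ring ring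
  ι-anticomm y z φ {suc n} vs = begin
    vs zero y * ι z φ ws + - ι y (slot (vs zero) (ι z φ)) ws
      ≈⟨ +-congˡ (-‿cong (ι-sub y φ (ι z (slot (vs zero) φ)) (vs zero z) ws)) ⟩
    vs zero y * ι z φ ws + - (vs zero z * ι y φ ws + - ι y (ι z (slot (vs zero) φ)) ws)
      ≈⟨ +-congˡ (-‿cong (+-congˡ (-‿cong (ι-anticomm y z (slot (vs zero) φ) ws)))) ⟩
    vs zero y * ι z φ ws + - (vs zero z * ι y φ ws + - - ι z (ι y (slot (vs zero) φ)) ws)
      ≈⟨ solve 3 (λ a b c → a :+ :- (b :+ :- :- c) := :- (b :+ :- (a :+ :- c))) refl _ _ _ ⟩
    - (vs zero z * ι y φ ws + - (vs zero y * ι z φ ws + - ι z (ι y (slot (vs zero) φ)) ws))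
      ≈⟨ -‿cong (+-congˡ (-‿cong (sym (ι-sub z φ (ι y (slot (vs zero) φ)) (vs zero y) ws)))) ⟩
    - (vs zero z * ι y φ ws + - ι z (slot (vs zero) (ι y φ)) ws) ∎
    where ws = vs ∘ suc

  -- In characteristic 2 anticommutativity says nothing about a repeated point, hence a separate
  -- induction.
  ι-square : ∀ y (φ : Form) → ι y (ι y φ) ≃ 0Form
  ι-square y φ {zero} vs = refl
  ι-square y φ {suc n} vs = begin
    vs zero y * ι y φ ws + - ι y (slot (vs zero) (ι y φ)) ws
      ≈⟨ +-congˡ (-‿cong (ι-sub y φ (ι y (slot (vs zero) φ)) (vs zero y) ws)) ⟩
    vs zero y * ι y φ ws + - (vs zero y * ι y φ ws + - ι y (ι y (slot (vs zero) φ)) ws)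
      ≈⟨ solve 2 (λ a b → a :+ :- (a :+ :- b) := b) refl _ _ ⟩
    ι y (ι y (slot (vs zero) φ)) ws
      ≈⟨ ι-square y (slot (vs zero) φ) ws ⟩
    0# ∎
    where ws = vs ∘ suc

  minor-repeated : ∀ {y xs} → y ∈ xs → minor (y ∷ xs) ≃ 0Form
  minor-repeated {y} {_ ∷ xs} (here ≡.refl) = ι-square y (minor xs)
  minor-repeated {y} {z ∷ xs} (there y∈xs) vs = begin
    ι y (ι z (minor xs)) vs    ≈⟨ ι-anticomm y z (minor xs) vs ⟩
    - ι z (ι y (minor xs)) vs  ≈⟨ -‿cong (ι-0 z (minor-repeated y∈xs) vs) ⟩
    - 0#                       ≈⟨ -0#≈0# ⟩
    0#                         ∎
    where open import Algebra.Properties.Ring ring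

  -- The factor is the sign of the permutation. Its existence suffices to carry the vanishing of a
  -- minor over to reordered points.
  minor-↭ : ∀ {xs ys} → xs ↭ ys → ∃ λ s → minor xs ≃ (λ vs → s * minor ys vs)
  minor-↭ ↭.refl = 1# , λ vs → sym (*-identityˡ _)
  minor-↭ (↭.prep y p) with minor-↭ p
  ... | s , h = s , λ vs → trans (ι-cong y h vs) (ι-scale y s _ vs)
  minor-↭ (↭.swap {ys = ys} y z p) with minor-↭ p
  ... | s , h = - s , λ vs → begin
    ι y (ι z _) vs               ≈⟨ ι-anticomm y z _ vs ⟩
    - ι z (ι y _) vs             ≈⟨ -‿cong (ι-cong z (λ us → trans (ι-cong y h us) (ι-scale y s (minor ys) us)) vs) ⟩
    - ι z (λ us → s * _) vs      ≈⟨ -‿cong (ι-scale z s (ι y (minor ys)) vs) ⟩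
    - (s * ι z (ι y _) vs)       ≈⟨ solve 2 (λ s a → :- (s :* a) := :- s :* a) refl s _ ⟩
    - s * ι z (ι y _) vs         ∎
  minor-↭ (↭.trans p q) with minor-↭ p | minor-↭ q
  ... | s , h | s′ , h′ = s * s′ , λ vs → trans (h vs) (trans (*-congˡ (h′ vs)) (sym (*-assoc s s′ _)))

  -- The point of the expansion does not enter, so the same coefficients serve for all points. If
  -- all bordered minors vanish, they form a linear relation among the vectors.
  cofactor : ∀ {n} → Form → (Fin n → X → Carrier) → Fin n → Carrier
  cofactor φ vs zero = φ (vs ∘ suc)
  cofactor φ vs (suc k) = - cofactor (slot (vs zero) φ) (vs ∘ suc) k

  ι-expand : ∀ {n} y (φ : Form) (vs : Fin n → X → Carrier) → ι y φ vs ≈ Σ[ (λ k → cofactor φ vs k * vs k y) ]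
  ι-expand {zero} y φ vs = refl
  ι-expand {suc n} y φ vs = +-cong (*-comm _ _) (begin
    - ι y (slot (vs zero) φ) ws
      ≈⟨ -‿cong (ι-expand y (slot (vs zero) φ) ws) ⟩
    - Σ[ (λ k → cofactor (slot (vs zero) φ) ws k * ws k y) ]
      ≈⟨ solve 1 (λ a → :- a := :- :1 :* a) refl _ ⟩
    - 1# * Σ[ (λ k → cofactor (slot (vs zero) φ) ws k * ws k y) ]
      ≈⟨ sym (Σ-* (- 1#) (λ k → cofactor (slot (vs zero) φ) ws k * ws k y)) ⟩
    Σ[ (λ k → - 1# * (cofactor (slot (vs zero) φ) ws k * ws k y)) ]
      ≈⟨ Σ-cong {n} (λ k → solve 2 (λ a b → :- :1 :* (a :* b) := :- a :* b) refl (cofactor (slot (vs zero) φ) ws k) (ws k y)) ⟩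
    Σ[ (λ k → - cofactor (slot (vs zero) φ) ws k * ws k y) ] ∎)
    where
    ws = vs ∘ suc

  IndepOn : ∀ {n} → List X → (Fin n → X → Carrier) → Set (c ⊔ ℓ ⊔ x)
  IndepOn {n} xs vs = (a : Fin n → Carrier) → (∀ {y} → y ∈ xs → Σ[ (λ k → a k * vs k y) ] ≈ 0#) → ¬ ¬ (∀ k → a k ≈ 0#)

  -- Border a nonzero minor of the tail by each point of `xs`. If all results vanished, the
  -- cofactors would be a relation whose leading coefficient is that minor, against independence.
  nonzero-minor : ∀ {n} xs (vs : Fin n → X → Carrier) → IndepOn xs vs →
    ¬ ¬ (∃ λ ys → (∀ {y} → y ∈ ys → y ∈ xs) × length ys ≡ n × ¬ (minor ys vs ≈ 0#))
  nonzero-minor {zero} xs vs indep k = k ([] , (λ ()) , ≡.refl , λ 1≈0 → 0≉1 (sym 1≈0))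
  nonzero-minor {suc n} xs vs indep k =
    nonzero-minor xs (vs ∘ suc) indep-tail λ { (ys , ys⊆xs , |ys|≡n , ys≉0) →
      ¬¬-All xs
        (λ {y} y∈xs y≉0 → k (y ∷ ys , (λ { (here ≡.refl) → y∈xs ; (there z∈) → ys⊆xs z∈ }) , ≡.cong suc |ys|≡n , y≉0))
        (λ all≈0 → indep (cofactor (minor ys) vs)
          (λ {y} y∈xs → trans (sym (ι-expand y (minor ys) vs)) (All.lookup all≈0 y∈xs))
          (λ a≈0 → ys≉0 (a≈0 zero))) }
    where
    indep-tail : IndepOn xs (vs ∘ suc)
    indep-tail a h k′ = indep (0# VF.∷ a)
      (λ y∈ → trans (+-cong (zeroˡ _) (h y∈)) (+-identityˡ 0#)) (λ a≈0 → k′ (a≈0 ∘ suc))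

  module _ (_≟_ : DecidableEquality X) where
    open DecMembership _≟_ using (_∈?_)

    unique⊎minor-0 : ∀ xs → Unique xs ⊎ (minor xs ≃ 0Form)
    unique⊎minor-0 [] = inj₁ []
    unique⊎minor-0 (y ∷ xs) with y ∈? xs
    ... | yes y∈xs = inj₂ (minor-repeated y∈xs)
    ... | no y∉xs with unique⊎minor-0 xs
    ...   | inj₁ xs! = inj₁ (All.tabulate (λ z∈xs → λ { ≡.refl → y∉xs z∈xs }) ∷ xs!)
    ...   | inj₂ h = inj₂ (ι-0 y h)

    -- The points of a nonzero minor do not repeat, so by counting they are a reordering of `xs`,
    -- and the minor on `xs` itself cannot vanish.
    square-minor : ∀ {n} xs (vs : Fin n → X → Carrier) → length xs ≡ n → IndepOn xs vs → ¬ (minor xs vs ≈ 0#)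
    square-minor xs vs |xs|≡n indep xs≈0 = nonzero-minor xs vs indep λ { (ys , ys⊆xs , |ys|≡n , ys≉0) →
      case-unique ys ys⊆xs |ys|≡n ys≉0 (unique⊎minor-0 ys) }
      where
      case-unique : ∀ ys → (∀ {y} → y ∈ ys → y ∈ xs) → length ys ≡ _ → ¬ (minor ys vs ≈ 0#) →
                    Unique ys ⊎ (minor ys ≃ 0Form) → ⊥
      case-unique ys ys⊆xs |ys|≡n ys≉0 (inj₂ h) = ys≉0 (h vs)
      case-unique ys ys⊆xs |ys|≡n ys≉0 (inj₁ ys!) with minor-↭ (Unique-⊆-↭ ys! ys⊆xs (≡.trans |ys|≡n (≡.sym |xs|≡n)))
      ... | s , h = ys≉0 (trans (h vs) (b≈0⇒ab≈0 xs≈0))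

    opaque
      -- Cramer's rule: expand the vanishing minor of the sequence g ∷ vs on the points y ∷ xs, where y ∈ xs.
      interpolate : ∀ {n} xs (vs : Fin n → X → Carrier) → length xs ≡ n → IndepOn xs vs →
        ∀ (g : X → Carrier) → ∃ λ (a : Fin n → Carrier) → ∀ {y} → y ∈ xs → g y ≈ Σ[ (λ k → a k * vs k y) ]
      interpolate {n} xs vs |xs|≡n indep g with inverse _ (square-minor xs vs |xs|≡n indep)
      ... | u , eq = (λ k → u * coef k) , λ {y} y∈xs → begin
        g y                                     ≈⟨ sym (*-identityʳ _) ⟩
        g y * 1#                                ≈⟨ *-congˡ (sym eq) ⟩
        g y * (minor xs vs * u)                 ≈⟨ solve 3 (λ a b c → a :* (b :* c) := c :* (a :* b)) refl _ _ _ ⟩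
        u * (g y * minor xs vs)                 ≈⟨ *-congˡ (a-b≈0⇒a≈b (minor-repeated y∈xs (g VF.∷ vs))) ⟩
        u * ι y (slot g (minor xs)) vs          ≈⟨ *-congˡ (ι-expand y (slot g (minor xs)) vs) ⟩
        u * Σ[ (λ k → coef k * vs k y) ]        ≈⟨ sym (Σ-* u (λ k → coef k * vs k y)) ⟩
        Σ[ (λ k → u * (coef k * vs k y)) ]      ≈⟨ Σ-cong {n} (λ k → sym (*-assoc u (coef k) (vs k y))) ⟩
        Σ[ (λ k → u * coef k * vs k y) ]        ∎
        where
        coef : Fin n → Carrier
        coef = cofactor (slot g (minor xs)) vs

-- Matrices of low weight.

sumℕ-mono : ∀ {n} {f g : Fin n → ℕ} → (∀ i → f i ≤ g i) → sumℕ f ≤ sumℕ g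
sumℕ-mono {zero} h = z≤n
sumℕ-mono {suc n} h = ℕ.+-mono-≤ (h zero) (sumℕ-mono (h ∘ suc))

sumℕ-const : ∀ n k → sumℕ {n} (λ _ → k) ≡ n ℕ.* k
sumℕ-const zero k = ≡.refl
sumℕ-const (suc n) k = ≡.cong (k ℕ.+_) (sumℕ-const n k)

sumℕ-+ : ∀ {n} (f g : Fin n → ℕ) → sumℕ (λ i → f i ℕ.+ g i) ≡ sumℕ f ℕ.+ sumℕ g
sumℕ-+ {zero} f g = ≡.refl
sumℕ-+ {suc n} f g = ≡.trans (≡.cong (f zero ℕ.+ g zero ℕ.+_) (sumℕ-+ (f ∘ suc) (g ∘ suc)))
  (solve 4 (λ a b s t → a :+ b :+ (s :+ t) := a :+ s :+ (b :+ t)) ≡.refl (f zero) (g zero) _ _)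
  where open import Data.Nat.Solver using (module +-*-Solver) ; open +-*-Solver

sumℕ-≡0 : ∀ {n} (f : Fin n → ℕ) → sumℕ f ≡ 0 → ∀ i → f i ≡ 0
sumℕ-≡0 f h zero = ℕ.m+n≡0⇒m≡0 (f zero) h
sumℕ-≡0 f h (suc i) = sumℕ-≡0 (f ∘ suc) (ℕ.m+n≡0⇒n≡0 (f zero) h) i

count-≡ : ∀ {n} → Fin n → Fin n → ℕ
count-≡ i j with i Fin.≟ j
... | yes _ = 1
... | no _ = 0

count-≡-suc : ∀ {n} (i j : Fin n) → count-≡ (suc i) (suc j) ≡ count-≡ i j
count-≡-suc i j with i Fin.≟ j
... | yes _ = ≡.refl
... | no _ = ≡.refl

sumℕ-count-≡ : ∀ {n} (i : Fin n) → sumℕ (count-≡ i) ≡ 1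
sumℕ-count-≡ {suc n} zero = ≡.cong suc (≡.trans (sumℕ-const n 0) (ℕ.*-zeroʳ n))
sumℕ-count-≡ {suc n} (suc i) = ≡.trans (sumℕ-cong (count-≡-suc i)) (sumℕ-count-≡ i)
  where
  sumℕ-cong : ∀ {n} {f g : Fin n → ℕ} → (∀ i → f i ≡ g i) → sumℕ f ≡ sumℕ g
  sumℕ-cong {zero} h = ≡.refl
  sumℕ-cong {suc n} h = ≡.cong₂ ℕ._+_ (h zero) (sumℕ-cong (h ∘ suc))

-- Double counting of the pairs `(i , l)` with `s i ≡ l`.
sumℕ-multiplicity : ∀ {n r} (s : Fin r → Fin n) → sumℕ (λ l → sumℕ (λ i → count-≡ (s i) l)) ≡ r
sumℕ-multiplicity {n} {zero} s = ≡.trans (sumℕ-const n 0) (ℕ.*-zeroʳ n)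
sumℕ-multiplicity {n} {suc r} s = ≡.trans (sumℕ-+ _ (λ l → sumℕ (λ i → count-≡ (s (suc i)) l)))
  (≡.cong₂ ℕ._+_ (sumℕ-count-≡ (s zero)) (sumℕ-multiplicity (s ∘ suc)))

count-≡0 : ∀ {n} (i j : Fin n) → count-≡ i j ≡ 0 → i ≢ j
count-≡0 i j h with i Fin.≟ j
... | no i≢j = i≢j

module LowWeight {c ℓ} (F : Field c ℓ) where
  open Field F hiding (zero)
  open LinearAlgebra F
  open FiniteSums F
  open ℤ-Coefficients commutativeRing

  -- Independence of rows is undecidable here, so a rank exists only up to double negation: descend
  -- from the bound `ρ` to the first size that is attained.
  ¬¬-rank : ∀ {n} (M : Mat n) i ρ → ¬ IndepRowsSub M i (suc ρ) → ¬ ¬ (∃ λ r → r ≤ ρ × RankSub M i r)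
  ¬¬-rank M i zero h k = k (0 , z≤n , ((λ ()) , (λ ()) , λ _ _ ()) , h)
  ¬¬-rank M i (suc ρ) h k =
    ¬¬-rank M i ρ (λ indep → k (suc ρ , ℕ.≤-refl , indep , h)) λ { (r , r≤ρ , rk) → k (r , ℕ.m≤n⇒m≤1+n r≤ρ , rk) }

  low-weight⇒¬¬0 : ∀ {n p} {C : Mat n → Set p} {δ} → MinDistance C δ → ∀ M → C M →
    ∀ ρ → (∀ i → ¬ IndepRowsSub M i (suc (ρ i))) → sumℕ ρ < δ → ¬ ¬ (M ≋ 0M)
  low-weight⇒¬¬0 (bound , _) M M∈C ρ h Σρ<δ M≢0 = ¬¬-∀ (λ i → ¬¬-rank M i (ρ i) (h i)) λ rk →
    ℕ.<⇒≱ Σρ<δ (ℕ.≤-trans (bound M M∈C M≢0 _ (proj₁ ∘ rk , proj₂ ∘ proj₂ ∘ rk , ≡.refl))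
      (sumℕ-mono (proj₁ ∘ proj₂ ∘ rk)))

  zero-block : ∀ {n} (M : Mat n) i r → (∀ k j → toℕ k ≤ toℕ i → toℕ i ≤ toℕ j → M k j ≈ 0#) →
    ¬ IndepRowsSub M i (suc r)
  zero-block M i r h (σ , σ≤i , indep) =
    0≉1 (sym (indep (λ _ → 1#) (λ j i≤j → Σ-zero λ k → b≈0⇒ab≈0 {1#} (h (σ k) j (σ≤i k) i≤j)) zero))

  -- Vanishing minors give the first two chosen rows a relation whose coefficients are their entries
  -- in column `j`, one negated. Independence kills these for every `j`, so the first row is zero,
  -- against independence once more. No nonzero entry has to be found.
  rank-one-block : ∀ {n} (M : Mat n) i r →
    (∀ k k′ j j′ → toℕ k ≤ toℕ i → toℕ k′ ≤ toℕ i → toℕ i ≤ toℕ j → toℕ i ≤ toℕ j′ →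
       M k j * M k′ j′ ≈ M k j′ * M k′ j) →
    ¬ IndepRowsSub M i (suc (suc r))
  rank-one-block {n} M i r minors (σ , σ≤i , indep) = 0≉1 (sym (indep e₀ e₀-relation zero))
    where
    row₀≈0 : ∀ j → toℕ i ≤ toℕ j → M (σ zero) j ≈ 0#
    row₀≈0 j i≤j = trans (solve 1 (λ a → a := :- (:- a)) refl _)
      (trans (-‿cong (indep a relation (suc zero))) (solve 0 (:- :0 := :0) refl))
      where
      a : Fin (suc (suc r)) → Carrier
      a = M (σ (suc zero)) j VF.∷ - M (σ zero) j VF.∷ λ _ → 0#
      relation : ∀ l → toℕ i ≤ toℕ l → Σ[ (λ k → a k * M (σ k) l) ] ≈ 0#
      relation l i≤l = trans
        (+-congˡ (trans (+-congˡ (Σ-zero {r} λ k → zeroˡ (M (σ (suc (suc k))) l))) (+-identityʳ _)))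
        (trans (solve 4 (λ a b c d → a :* b :+ :- c :* d := a :* b :- c :* d) refl _ _ _ _)
        (a≈b⇒a-b≈0 (trans (minors _ _ j l (σ≤i _) (σ≤i _) i≤j i≤l) (*-comm _ _))))
    e₀ : Fin (suc (suc r)) → Carrier
    e₀ = 1# VF.∷ λ _ → 0#
    e₀-relation : ∀ l → toℕ i ≤ toℕ l → Σ[ (λ k → e₀ k * M (σ k) l) ] ≈ 0#
    e₀-relation l i≤l = trans (+-cong (b≈0⇒ab≈0 (row₀≈0 l i≤l)) (Σ-zero {suc r} λ k → zeroˡ (M (σ (suc k)) l))) (+-identityˡ 0#)

  module _ {m p} {C : Mat (suc (suc (suc m))) → Set p} (dist : MinDistance C 4) where

    -- The first block is a single row, the third is supported in one column, and the second is
    -- governed by the one minor assumed to vanish. Each has rank at most 1, and the later blocks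
    -- are zero.
    three-block : ∀ M → C M → (∀ k j → 2 < toℕ j → M k j ≈ 0#) →
      M zero (suc zero) * M (suc zero) (suc (suc zero)) ≈ M zero (suc (suc zero)) * M (suc zero) (suc zero) →
      ¬ ¬ (M ≋ 0M)
    three-block M M∈C cols minor = low-weight⇒¬¬0 dist M M∈C ρ rank≤ρ
      (s≤s (s≤s (s≤s (s≤s (ℕ.≤-reflexive (≡.trans (sumℕ-const m 0) (ℕ.*-zeroʳ m)))))))
      where
      ρ : Fin (suc (suc (suc m))) → ℕ
      ρ zero = 1
      ρ (suc zero) = 1
      ρ (suc (suc zero)) = 1
      ρ (suc (suc (suc _))) = 0

      2<3+ : ∀ {n} → 2 < suc (suc (suc n))
      2<3+ = s≤s (s≤s (s≤s z≤n))

      outside : ∀ {k k′ j j′} → (2 < toℕ j ⊎ 2 < toℕ j′) → M k j * M k′ j′ ≈ M k j′ * M k′ j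
      outside (inj₁ 2<j) = trans (a≈0⇒ab≈0 (cols _ _ 2<j)) (sym (b≈0⇒ab≈0 (cols _ _ 2<j)))
      outside (inj₂ 2<j′) = trans (b≈0⇒ab≈0 (cols _ _ 2<j′)) (sym (a≈0⇒ab≈0 (cols _ _ 2<j′)))

      rank≤ρ : ∀ i → ¬ IndepRowsSub M i (suc (ρ i))
      rank≤ρ zero = rank-one-block M zero 0 λ { zero zero j j′ z≤n z≤n _ _ → *-comm _ _ }
      rank≤ρ (suc zero) = rank-one-block M (suc zero) 0 minors
        where
        columns : ∀ k k′ (j j′ : Fin (suc (suc (suc m)))) → 1 ≤ toℕ j → 1 ≤ toℕ j′ →
          M k (suc zero) * M k′ (suc (suc zero)) ≈ M k (suc (suc zero)) * M k′ (suc zero) →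
          M k j * M k′ j′ ≈ M k j′ * M k′ j
        columns k k′ (suc zero) (suc zero) _ _ _ = refl
        columns k k′ (suc zero) (suc (suc zero)) _ _ eq = eq
        columns k k′ (suc (suc zero)) (suc zero) _ _ eq = sym eq
        columns k k′ (suc (suc zero)) (suc (suc zero)) _ _ _ = refl
        columns k k′ (suc (suc (suc j))) j′ _ _ _ = outside (inj₁ 2<3+)
        columns k k′ j@(suc zero) (suc (suc (suc j′))) _ _ _ = outside {j = j} (inj₂ 2<3+)
        columns k k′ j@(suc (suc zero)) (suc (suc (suc j′))) _ _ _ = outside {j = j} (inj₂ 2<3+)
        minors : ∀ k k′ j j′ → toℕ k ≤ 1 → toℕ k′ ≤ 1 → 1 ≤ toℕ j → 1 ≤ toℕ j′ →
          M k j * M k′ j′ ≈ M k j′ * M k′ j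
        minors zero zero j j′ _ _ _ _ = *-comm _ _
        minors zero (suc zero) j j′ _ _ 1≤j 1≤j′ = columns _ _ j j′ 1≤j 1≤j′ minor
        minors (suc zero) zero j j′ _ _ 1≤j 1≤j′ = columns _ _ j j′ 1≤j 1≤j′
          (trans (*-comm _ _) (trans (sym minor) (*-comm _ _)))
        minors (suc zero) (suc zero) j j′ _ _ _ _ = *-comm _ _
        minors (suc (suc _)) _ _ _ (s≤s ()) _ _ _
        minors zero (suc (suc _)) _ _ _ (s≤s ()) _ _
        minors (suc zero) (suc (suc _)) _ _ _ (s≤s ()) _ _
      rank≤ρ (suc (suc zero)) = rank-one-block M (suc (suc zero)) 0 minors
        where
        minors : ∀ k k′ j j′ → toℕ k ≤ 2 → toℕ k′ ≤ 2 → 2 ≤ toℕ j → 2 ≤ toℕ j′ →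
          M k j * M k′ j′ ≈ M k j′ * M k′ j
        minors k k′ j j′ _ _ 2≤j 2≤j′ with ℕ.m≤n⇒m<n∨m≡n 2≤j | ℕ.m≤n⇒m<n∨m≡n 2≤j′
        ... | inj₁ 2<j | _ = outside (inj₁ 2<j)
        ... | _ | inj₁ 2<j′ = outside {j = j} (inj₂ 2<j′)
        ... | inj₂ 2≡j | inj₂ 2≡j′ with Fin.toℕ-injective (≡.trans (≡.sym 2≡j) 2≡j′)
        ...   | ≡.refl = refl
      rank≤ρ i@(suc (suc (suc _))) = zero-block M i 0 λ k j _ i≤j → cols k j (ℕ.≤-trans 2<3+ i≤j)

  δ : ∀ {n} → Fin n → Fin n → Carrier
  δ i j with i Fin.≟ j
  ... | yes _ = 1#
  ... | no _ = 0#

  δ-≡ : ∀ {n} (i : Fin n) → δ i i ≈ 1#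
  δ-≡ i with i Fin.≟ i
  ... | yes _ = refl
  ... | no i≢i = contradiction ≡.refl i≢i

  δ-≢ : ∀ {n} {i j : Fin n} → i ≢ j → δ i j ≈ 0#
  δ-≢ {i = i} {j} i≢j with i Fin.≟ j
  ... | yes i≡j = contradiction i≡j i≢j
  ... | no _ = refl

  diagonal : ∀ {n} → (Fin n → Carrier) → Mat n
  diagonal d i j = d i * δ i j

  diagonal-rank : ∀ {n} (d : Fin n → Carrier) l r → (r ≡ 0 → d l ≈ 0#) → ¬ IndepRowsSub (diagonal d) l (suc r)
  diagonal-rank d l zero d≈0 = zero-block (diagonal d) l 0 zeros
    where
    zeros : ∀ k j → toℕ k ≤ toℕ l → toℕ l ≤ toℕ j → diagonal d k j ≈ 0#
    zeros k j k≤l l≤j with k Fin.≟ j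
    ... | no k≢j = zeroʳ _
    ... | yes ≡.refl with Fin.toℕ-injective (ℕ.≤-antisym k≤l l≤j)
    ...   | ≡.refl = a≈0⇒ab≈0 (d≈0 ≡.refl)
  diagonal-rank d l (suc r) _ = rank-one-block (diagonal d) l r minors
    where
    entry : ∀ k j → toℕ k ≤ toℕ l → toℕ l ≤ toℕ j → (k ≡ l × j ≡ l) ⊎ (diagonal d k j ≈ 0#)
    entry k j k≤l l≤j with k Fin.≟ j
    ... | no k≢j = inj₂ (zeroʳ _)
    ... | yes ≡.refl = inj₁ (eq , eq)
      where
      eq : k ≡ l
      eq = Fin.toℕ-injective (ℕ.≤-antisym k≤l l≤j)
    minors : ∀ k k′ j j′ → toℕ k ≤ toℕ l → toℕ k′ ≤ toℕ l → toℕ l ≤ toℕ j → toℕ l ≤ toℕ j′ →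
      diagonal d k j * diagonal d k′ j′ ≈ diagonal d k j′ * diagonal d k′ j
    minors k k′ j j′ k≤ k′≤ ≤j ≤j′ with entry k j k≤ ≤j | entry k′ j′ k′≤ ≤j′ | entry k j′ k≤ ≤j′ | entry k′ j k′≤ ≤j
    ... | inj₁ (≡.refl , ≡.refl) | inj₁ (≡.refl , ≡.refl) | _ | _ = refl
    ... | _ | _ | inj₁ (≡.refl , ≡.refl) | inj₁ (≡.refl , ≡.refl) = refl
    ... | inj₂ e | _ | inj₂ f | _ = trans (a≈0⇒ab≈0 e) (sym (a≈0⇒ab≈0 f))
    ... | inj₂ e | _ | _ | inj₂ f = trans (a≈0⇒ab≈0 e) (sym (b≈0⇒ab≈0 f))
    ... | _ | inj₂ e | inj₂ f | _ = trans (b≈0⇒ab≈0 e) (sym (a≈0⇒ab≈0 f))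
    ... | _ | inj₂ e | _ | inj₂ f = trans (b≈0⇒ab≈0 e) (sym (b≈0⇒ab≈0 f))

  -- The multiplicity of `l` among the `s i` bounds the rank of block `l`, and the multiplicities
  -- add up to `r`. Injectivity of `s` then makes `a i` the diagonal entry at `s i`.
  diagonal-sum : ∀ {n p} {C : Mat n → Set p} {μ} → MinDistance C μ → ∀ {r} → r < μ → (s : Fin r → Fin n) →
    Injective _≡_ _≡_ s → (a : Fin r → Carrier) → C (diagonal (λ l → Σ[ (λ i → a i * δ (s i) l) ])) →
    ¬ ¬ (∀ i → a i ≈ 0#)
  diagonal-sum {n} dist {r} r<μ s s-inj a M∈C k =
    low-weight⇒¬¬0 dist (diagonal d) M∈C ρ (λ l → diagonal-rank d l (ρ l) (d≈0 l))
      (≡.subst (_< _) (≡.sym (sumℕ-multiplicity s)) r<μ)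
      λ M≈0 → k λ i → trans (sym (d[si]≈a i)) (trans (sym (trans (*-congˡ (δ-≡ (s i))) (*-identityʳ _))) (M≈0 (s i) (s i)))
    where
    d : Fin n → Carrier
    d l = Σ[ (λ i → a i * δ (s i) l) ]
    ρ : Fin n → ℕ
    ρ l = sumℕ (λ i → count-≡ (s i) l)
    d≈0 : ∀ l → ρ l ≡ 0 → d l ≈ 0#
    d≈0 l ρl≡0 = Σ-zero λ i → b≈0⇒ab≈0 (δ-≢ (count-≡0 (s i) l (sumℕ-≡0 _ ρl≡0 i)))
    d[si]≈a : ∀ i → d (s i) ≈ a i
    d[si]≈a i = trans (Σ-single i (λ j j≢i → b≈0⇒ab≈0 (δ-≢ (j≢i ∘ s-inj))))
      (trans (*-congˡ (δ-≡ (s i))) (*-identityʳ _))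

-- Positions of the upper triangle inside and outside W.

upperPositions : ∀ n → List (Fin n × Fin n)
upperPositions zero = []
upperPositions (suc n) = List.map (zero ,_) (allFin (suc n)) ++ List.map (λ (i , j) → suc i , suc j) (upperPositions n)

∈-upperPositions : ∀ {n} (i j : Fin n) → toℕ i ≤ toℕ j → (i , j) ∈ upperPositions n
∈-upperPositions zero j _ = ∈-++⁺ˡ (∈-map⁺ (zero ,_) (∈-allFin j))
∈-upperPositions {suc n} (suc i) (suc j) (s≤s i≤j) =
  ∈-++⁺ʳ (List.map (zero ,_) (allFin (suc n))) (∈-map⁺ (λ (i , j) → suc i , suc j) (∈-upperPositions i j i≤j))

length-upperPositions : ∀ n → 2 ℕ.* length (upperPositions n) ≡ n ℕ.* suc n
length-upperPositions zero = ≡.refl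
length-upperPositions (suc n) = begin
  2 ℕ.* length (upperPositions (suc n))
    ≡⟨ ≡.cong (2 ℕ.*_) (length-++ (List.map (zero ,_) (allFin (suc n)))) ⟩
  2 ℕ.* (length (List.map (zero {n} ,_) (allFin (suc n))) ℕ.+ length (List.map (λ ((i , j) : Fin n × Fin n) → suc i , suc j) (upperPositions n)))
    ≡⟨ ≡.cong (2 ℕ.*_) (≡.cong₂ ℕ._+_ (≡.trans (length-map (zero ,_) (allFin (suc n))) (length-tabulate {n = suc n} id)) (length-map _ (upperPositions n))) ⟩
  2 ℕ.* (suc n ℕ.+ length (upperPositions n))
    ≡⟨ ℕ.*-distribˡ-+ 2 (suc n) (length (upperPositions n)) ⟩
  2 ℕ.* suc n ℕ.+ 2 ℕ.* length (upperPositions n)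
    ≡⟨ ≡.cong (2 ℕ.* suc n ℕ.+_) (length-upperPositions n) ⟩
  2 ℕ.* suc n ℕ.+ n ℕ.* suc n
    ≡⟨ solve 1 (λ n → con 2 :* (con 1 :+ n) :+ n :* (con 1 :+ n) := (con 1 :+ n) :* (con 2 :+ n)) ≡.refl n ⟩
  suc n ℕ.* suc (suc n) ∎
  where
  open ≡.≡-Reasoning
  open import Data.Nat.Solver using (module +-*-Solver)
  open +-*-Solver

-- The four positions left out support the blocks [[a,b],[0,d]] ⊕ [f], all of weight at most 3.
module Positions (m : ℕ) where
  Position : Set
  Position = Fin (suc (suc (suc m))) × Fin (suc (suc (suc m)))

  corner : Fin 4 → Position
  corner zero = zero , zero
  corner (suc zero) = zero , suc zero
  corner (suc (suc zero)) = suc zero , suc zero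
  corner (suc (suc (suc zero))) = suc (suc zero) , suc (suc zero)

  shift₂ : Fin (suc m) → Fin (suc (suc (suc m)))
  shift₂ j = suc (suc j)

  shift₃ : Fin m → Fin (suc (suc (suc m)))
  shift₃ j = suc (suc (suc j))

  row₀ row₁ row₂ rest positions : List Position
  row₀ = List.map (λ j → zero , shift₂ j) (allFin (suc m))
  row₁ = List.map (λ j → suc zero , shift₂ j) (allFin (suc m))
  row₂ = List.map (λ j → suc (suc zero) , shift₃ j) (allFin m)
  rest = List.map (λ (i , j) → shift₃ i , shift₃ j) (upperPositions m)
  positions = row₀ ++ row₁ ++ row₂ ++ rest

  ∈row₀ : ∀ j → (zero , shift₂ j) ∈ positions
  ∈row₀ j = ∈-++⁺ˡ (∈-map⁺ (λ j → zero , shift₂ j) (∈-allFin j))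

  ∈row₁ : ∀ j → (suc zero , shift₂ j) ∈ positions
  ∈row₁ j = ∈-++⁺ʳ row₀ (∈-++⁺ˡ (∈-map⁺ (λ j → suc zero , shift₂ j) (∈-allFin j)))

  ∈row₂ : ∀ j → (suc (suc zero) , shift₃ j) ∈ positions
  ∈row₂ j = ∈-++⁺ʳ row₀ (∈-++⁺ʳ row₁ (∈-++⁺ˡ (∈-map⁺ (λ j → suc (suc zero) , shift₃ j) (∈-allFin j))))

  ∈rest : ∀ i j → toℕ i ≤ toℕ j → (shift₃ i , shift₃ j) ∈ positions
  ∈rest i j i≤j = ∈-++⁺ʳ row₀ (∈-++⁺ʳ row₁ (∈-++⁺ʳ row₂
    (∈-map⁺ (λ (i , j) → shift₃ i , shift₃ j) (∈-upperPositions i j i≤j))))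

  data Classified (i j : Fin (suc (suc (suc m)))) : Set where
    below : toℕ j < toℕ i → Classified i j
    at-corner : ∀ l → corner l ≡ (i , j) → Classified i j
    listed : (i , j) ∈ positions → Classified i j

  classify : ∀ i j → Classified i j
  classify zero zero = at-corner zero ≡.refl
  classify zero (suc zero) = at-corner (suc zero) ≡.refl
  classify zero (suc (suc j)) = listed (∈row₀ j)
  classify (suc i) zero = below (s≤s z≤n)
  classify (suc zero) (suc zero) = at-corner (suc (suc zero)) ≡.refl
  classify (suc zero) (suc (suc j)) = listed (∈row₁ j)
  classify (suc (suc i)) (suc zero) = below (s≤s (s≤s z≤n))
  classify (suc (suc zero)) (suc (suc zero)) = at-corner (suc (suc (suc zero))) ≡.refl
  classify (suc (suc zero)) (suc (suc (suc j))) = listed (∈row₂ j)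
  classify (suc (suc (suc i))) (suc (suc zero)) = below (s≤s (s≤s (s≤s z≤n)))
  classify (suc (suc (suc i))) (suc (suc (suc j))) with toℕ i ℕ.≤? toℕ j
  ... | yes i≤j = listed (∈rest i j i≤j)
  ... | no i≰j = below (s≤s (s≤s (s≤s (ℕ.≰⇒> i≰j))))

  listed-last-column : ∀ i j → 2 < toℕ j → toℕ j < toℕ i ⊎ (i , j) ∈ positions
  listed-last-column i j 2<j with classify i j
  ... | below j<i = inj₁ j<i
  ... | listed ∈ = inj₂ ∈
  listed-last-column i j () | at-corner zero ≡.refl
  listed-last-column i j (s≤s ()) | at-corner (suc zero) ≡.refl
  listed-last-column i j (s≤s ()) | at-corner (suc (suc zero)) ≡.refl
  listed-last-column i j (s≤s (s≤s ())) | at-corner (suc (suc (suc zero))) ≡.refl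

  length-positions : ∀ t → 2 ℕ.* (t ℕ.+ 4) ≡ suc (suc (suc m)) ℕ.* suc (suc (suc (suc m))) → length positions ≡ t
  length-positions t eq = ℕ.+-cancelʳ-≡ 4 _ _ (ℕ.*-cancelˡ-≡ _ _ 2 (begin
    2 ℕ.* (length positions ℕ.+ 4)
      ≡⟨ ≡.cong (λ l → 2 ℕ.* (l ℕ.+ 4)) count ⟩
    2 ℕ.* (suc m ℕ.+ (suc m ℕ.+ (m ℕ.+ length (upperPositions m))) ℕ.+ 4)
      ≡⟨ solve 2 (λ m u → con 2 :* (con 1 :+ m :+ (con 1 :+ m :+ (m :+ u)) :+ con 4) := con 2 :* u :+ (con 6 :* m :+ con 12)) ≡.refl m _ ⟩
    2 ℕ.* length (upperPositions m) ℕ.+ (6 ℕ.* m ℕ.+ 12)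
      ≡⟨ ≡.cong (ℕ._+ (6 ℕ.* m ℕ.+ 12)) (length-upperPositions m) ⟩
    m ℕ.* suc m ℕ.+ (6 ℕ.* m ℕ.+ 12)
      ≡⟨ solve 1 (λ m → m :* (con 1 :+ m) :+ (con 6 :* m :+ con 12) := (con 3 :+ m) :* (con 4 :+ m)) ≡.refl m ⟩
    suc (suc (suc m)) ℕ.* suc (suc (suc (suc m)))
      ≡⟨ eq ⟨
    2 ℕ.* (t ℕ.+ 4) ∎))
    where
    open ≡.≡-Reasoning
    open import Data.Nat.Solver using (module +-*-Solver)
    open +-*-Solver
    length-row : ∀ {n} (f : Fin n → Position) → length (List.map f (allFin n)) ≡ n
    length-row f = ≡.trans (length-map f (allFin _)) (length-tabulate id)
    count : length positions ≡ suc m ℕ.+ (suc m ℕ.+ (m ℕ.+ length (upperPositions m)))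
    count = ≡.trans (length-++ row₀ {row₁ ++ row₂ ++ rest}) (≡.cong₂ ℕ._+_ (length-row (λ j → zero , shift₂ j))
      (≡.trans (length-++ row₁ {row₂ ++ rest}) (≡.cong₂ ℕ._+_ (length-row (λ j → suc zero , shift₂ j))
      (≡.trans (length-++ row₂ {rest}) (≡.cong₂ ℕ._+_ (length-row (λ j → suc (suc zero) , shift₃ j))
        (length-map (λ ((i , j) : Fin m × Fin m) → shift₃ i , shift₃ j) (upperPositions m)))))))

-- From weak to full linear independence.

module Elimination {c ℓ} (F : Field c ℓ) where
  open Field F hiding (zero)
  open LinearAlgebra F
  open FiniteSums F
  open ℤ-Coefficients commutativeRing
  open import Relation.Binary.Reasoning.Setoid setoid

  -- The constructive substitute for choosing a pivot: where equality is decidable one nonzero entry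
  -- would do, here `u` may have to combine several.
  LeftInvertible : Set (c ⊔ ℓ)
  LeftInvertible = ∀ {m} (v : Vector m) → ¬ (∀ j → v j ≈ 0#) → ∃ λ (u : Vector m) → Σ[ (λ j → u j * v j) ] ≈ 1#

  WeaklyIndep : ∀ {k m} → (Fin k → Vector m) → Set (c ⊔ ℓ)
  WeaklyIndep {k} v = (a : Fin k → Carrier) → (∀ j → Σ[ (λ i → a i * v i j) ] ≈ 0#) → ¬ ¬ (∀ i → a i ≈ 0#)

  -- Gaussian elimination with the functional `u` as pivot. The vectors `w i` are the remaining ones
  -- reduced so that `u` annihilates them; they stay weakly independent, and the recursion makes
  -- them independent.
  strengthen : LeftInvertible → ∀ {k m} (v : Fin k → Vector m) → WeaklyIndep v → LinIndep v
  strengthen inv {zero} v _ a _ ()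
  strengthen inv {suc k} {m} v weak a rel = λ { zero → a₀≈0 ; (suc i) → as≈0 i }
    where
    v₀ = v zero
    v₀≢0 : ¬ (∀ j → v₀ j ≈ 0#)
    v₀≢0 v₀≈0 = weak (1# VF.∷ λ _ → 0#)
      (λ j → trans (+-cong (b≈0⇒ab≈0 (v₀≈0 j)) (Σ-zero {k} λ i → zeroˡ (v (suc i) j))) (+-identityˡ 0#))
      λ h → 0≉1 (sym (h zero))
    u = proj₁ (inv v₀ v₀≢0)
    uv₀≈1 : Σ[ (λ j → u j * v₀ j) ] ≈ 1#
    uv₀≈1 = proj₂ (inv v₀ v₀≢0)
    p : Fin k → Carrier
    p i = Σ[ (λ j → u j * v (suc i) j) ]
    w : Fin k → Vector m
    w i j = v (suc i) j + - (p i * v₀ j)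

    w-comb : ∀ (b : Fin k → Carrier) j → Σ[ (λ i → b i * w i j) ] ≈
      - Σ[ (λ i → b i * p i) ] * v₀ j + Σ[ (λ i → b i * v (suc i) j) ]
    w-comb b j = begin
      Σ[ (λ i → b i * w i j) ]
        ≈⟨ Σ-cong {k} (λ i → solve 4 (λ b v p v₀ → b :* (v :+ :- (p :* v₀)) := :1 :* (b :* v) :+ :- v₀ :* (b :* p)) refl (b i) (v (suc i) j) (p i) (v₀ j)) ⟩
      Σ[ (λ i → 1# * (b i * v (suc i) j) + - v₀ j * (b i * p i)) ]
        ≈⟨ Σ-linear 1# (- v₀ j) (λ i → b i * v (suc i) j) (λ i → b i * p i) ⟩
      1# * Σ[ (λ i → b i * v (suc i) j) ] + - v₀ j * Σ[ (λ i → b i * p i) ]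
        ≈⟨ solve 3 (λ s v₀ q → :1 :* s :+ :- v₀ :* q := :- q :* v₀ :+ s) refl _ _ _ ⟩
      - Σ[ (λ i → b i * p i) ] * v₀ j + Σ[ (λ i → b i * v (suc i) j) ] ∎

    w-weak : WeaklyIndep w
    w-weak b rel′ k′ = weak (- Σ[ (λ i → b i * p i) ] VF.∷ b) (λ j → trans (sym (w-comb b j)) (rel′ j)) λ h → k′ (h ∘ suc)

    -- Applying u to the given relation identifies its first coefficient.
    a₀≈ : a zero ≈ - Σ[ (λ i → a (suc i) * p i) ]
    a₀≈ = trans (a-b≈0⇒a≈b (trans (solve 2 (λ a q → a :+ :- (:- q) := a :+ q) refl _ _) (begin
      a zero + Σ[ (λ i → a (suc i) * p i) ]
        ≈⟨ +-congʳ (trans (sym (*-identityʳ _)) (*-congˡ (sym uv₀≈1))) ⟩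
      a zero * Σ[ (λ j → u j * v₀ j) ] + Σ[ (λ i → a (suc i) * p i) ]
        ≈⟨ +-congˡ (Σ-cong {k} λ i → refl) ⟩
      Σ[ (λ i → a i * Σ[ (λ j → u j * v i j) ]) ]
        ≈⟨ Σ-cong {suc k} (λ i → sym (Σ-* (a i) (λ j → u j * v i j))) ⟩
      Σ[ (λ i → Σ[ (λ j → a i * (u j * v i j)) ]) ]
        ≈⟨ Σ-swap (λ i j → a i * (u j * v i j)) ⟩
      Σ[ (λ j → Σ[ (λ i → a i * (u j * v i j)) ]) ]
        ≈⟨ Σ-zero {m} (λ j → trans (Σ-cong {suc k} λ i → solve 3 (λ a u v → a :* (u :* v) := u :* (a :* v)) refl (a i) (u j) (v i j))
             (trans (Σ-* (u j) (λ i → a i * v i j)) (b≈0⇒ab≈0 (rel j)))) ⟩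
      0# ∎))) refl

    as≈0 : ∀ i → a (suc i) ≈ 0#
    as≈0 = strengthen inv w w-weak (a ∘ suc) λ j →
      trans (w-comb (a ∘ suc) j) (trans (+-congʳ (*-congʳ (sym a₀≈))) (rel j))

    a₀≈0 : a zero ≈ 0#
    a₀≈0 = trans a₀≈ (trans (-‿cong (Σ-zero λ i → a≈0⇒ab≈0 (as≈0 i))) (solve 0 (:- :0 := :0) refl))

-- The cap determined by a code.

module CapFromCode {c ℓ p} (F : Field c ℓ) {m t : ℕ}
  (dim : 2 ℕ.* (t ℕ.+ 4) ≡ suc (suc (suc m)) ℕ.* suc (suc (suc (suc m))))
  {C : LinearAlgebra.Mat F (suc (suc (suc m))) → Set p}
  (code : LinearAlgebra.Code F (suc (suc (suc m))) t 4 C) where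
  open Field F hiding (zero)
  open LinearAlgebra F
  open FiniteSums F
  open LowWeight F
  open Elimination F
  open Positions m
  open Code code
  open IsSubspaceU subspace
  open ℤ-Coefficients commutativeRing
  open Minors F {X = Position} using (IndepOn; interpolate)

  n : ℕ
  n = suc (suc (suc m))

  combination : (Fin t → Carrier) → Mat n
  combination a i j = Σ[ (λ k → a k * basis k i j) ]

  combination∈ : ∀ a → C (combination a)
  combination∈ a = go a basis basis∈
    where
    go : ∀ {k} (a : Fin k → Carrier) (b : Fin k → Mat n) → (∀ l → C (b l)) → C (λ i j → Σ[ (λ l → a l * b l i j) ])
    go {zero} a b b∈ = zero∈
    go {suc k} a b b∈ = +-closed _ _ (·-closed (a zero) (b zero) (b∈ zero)) (go (a ∘ suc) (b ∘ suc) (b∈ ∘ suc))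

  entries : Fin t → Position → Carrier
  entries k = uncurry (basis k)

  -- Such an `M` lies in W, and the minor required by `three-block` vanishes because both of its
  -- entries in the third column do.
  vanish-on-positions : ∀ M → C M → (∀ {y} → y ∈ positions → uncurry M y ≈ 0#) → ¬ ¬ (M ≋ 0M)
  vanish-on-positions M M∈C h = three-block distance M M∈C
    (λ i j 2<j → [ upper M M∈C i j , h ] (listed-last-column i j 2<j))
    (trans (b≈0⇒ab≈0 (h (∈row₁ zero))) (sym (a≈0⇒ab≈0 (h (∈row₀ zero)))))

  indep-on-positions : IndepOn positions entries
  indep-on-positions a h k = vanish-on-positions (combination a) (combination∈ a) h λ M≈0 → k (basis-indep a M≈0)

  opaque
    -- For upper triangular `g`, subtracting this combination leaves an element of W: this is the
    -- projection along the code.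
    project : (g : Mat n) → ∃ λ a → ∀ {y} → y ∈ positions → uncurry g y ≈ uncurry (combination a) y
    project g = interpolate (≡-dec Fin._≟_ Fin._≟_) positions entries (length-positions t dim) indep-on-positions (uncurry g)

  pattern at₁ = suc zero
  pattern at₂ = suc (suc zero)

  unit-matrix : Position → Mat n
  unit-matrix (k , l) i j = δ k i * δ l j

  -- Modulo W these are the units in the first and second rows of the third column, so `x A + y B`
  -- has entries `x` and `y` there.
  A B : Mat n
  A = combination (proj₁ (project (unit-matrix (zero , at₂))))
  B = combination (proj₁ (project (unit-matrix (at₁ , at₂))))

  A∈ : C A
  A∈ = combination∈ (proj₁ (project (unit-matrix (zero , at₂))))
  B∈ : C B
  B∈ = combination∈ (proj₁ (project (unit-matrix (at₁ , at₂))))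

  on-positions-A : ∀ {y} → y ∈ positions → uncurry A y ≈ uncurry (unit-matrix (zero , at₂)) y
  on-positions-A y∈ = sym (proj₂ (project (unit-matrix (zero , at₂))) y∈)
  on-positions-B : ∀ {y} → y ∈ positions → uncurry B y ≈ uncurry (unit-matrix (at₁ , at₂)) y
  on-positions-B y∈ = sym (proj₂ (project (unit-matrix (at₁ , at₂))) y∈)

  unit-cols : ∀ k {i j} → 2 < toℕ j → unit-matrix (k , at₂) i j ≈ 0#
  unit-cols k {j = j} 2<j = b≈0⇒ab≈0 (δ-≢ λ at₂≡j → ℕ.<-irrefl (≡.cong toℕ at₂≡j) 2<j)

  cols-A : ∀ i j → 2 < toℕ j → A i j ≈ 0#
  cols-A i j 2<j = [ upper A A∈ i j , (λ ∈ → trans (on-positions-A ∈) (unit-cols zero {i} 2<j)) ] (listed-last-column i j 2<j)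
  cols-B : ∀ i j → 2 < toℕ j → B i j ≈ 0#
  cols-B i j 2<j = [ upper B B∈ i j , (λ ∈ → trans (on-positions-B ∈) (unit-cols at₁ {i} 2<j)) ] (listed-last-column i j 2<j)

  A₀₂ : A zero at₂ ≈ 1#
  A₀₂ = trans (on-positions-A (∈row₀ zero)) (*-identityˡ _)
  A₁₂ : A at₁ at₂ ≈ 0#
  A₁₂ = trans (on-positions-A (∈row₁ zero)) (zeroˡ _)
  B₀₂ : B zero at₂ ≈ 0#
  B₀₂ = trans (on-positions-B (∈row₀ zero)) (zeroˡ _)
  B₁₂ : B at₁ at₂ ≈ 1#
  B₁₂ = trans (on-positions-B (∈row₁ zero)) (*-identityˡ _)

  -- N x y is the 2×2 minor of x A + y B in rows 1,2 and columns 2,3.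
  N : Carrier → Carrier → Carrier
  N x y = (x * A zero at₁ + y * B zero at₁) * y + - (x * (x * A at₁ at₁ + y * B at₁ at₁))

  -- A zero of `N` makes the codeword `x A + y B` satisfy `three-block`; `x` and `y` are then read
  -- off as entries of a vanishing matrix.
  anisotropic : ∀ x y → N x y ≈ 0# → ¬ ¬ (x ≈ 0# × y ≈ 0#)
  anisotropic x y N≈0 k = three-block distance M (+-closed _ _ (·-closed x A A∈) (·-closed y B B∈))
    (λ i j 2<j → trans (+-cong (b≈0⇒ab≈0 (cols-A i j 2<j)) (b≈0⇒ab≈0 (cols-B i j 2<j))) (+-identityˡ 0#))
    (trans (*-congˡ M₁₂) (trans (a-b≈0⇒a≈b N≈0) (*-congʳ (sym M₀₂))))
    λ M≈0 → k (trans (sym M₀₂) (M≈0 zero at₂) , trans (sym M₁₂) (M≈0 at₁ at₂))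
    where
    M : Mat n
    M = (x ·M A) +M (y ·M B)
    M₀₂ : M zero at₂ ≈ x
    M₀₂ = trans (+-cong (*-congˡ A₀₂) (*-congˡ B₀₂)) (solve 2 (λ x y → x :* :1 :+ y :* :0 := x) refl x y)
    M₁₂ : M at₁ at₂ ≈ y
    M₁₂ = trans (+-cong (*-congˡ A₁₂) (*-congˡ B₁₂)) (solve 2 (λ x y → x :* :0 :+ y :* :1 := y) refl x y)

  -- Iterating N turns "not all zero" into a single nonzero, hence invertible, element of the ideal.
  norm : ∀ {k} (v : Vector k) → ∃ λ (u : Vector k) → Σ[ (λ j → u j * v j) ] ≈ 0# → ¬ ¬ (∀ j → v j ≈ 0#)
  norm {zero} v = (λ ()) , λ _ k → k λ ()
  norm {suc k} v with norm (v ∘ suc)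
  ... | u , h = (g VF.∷ λ j → g′ * u j) , λ eq k′ → anisotropic (v zero) s (trans N≈ eq)
      λ (v₀≈0 , s≈0) → h s≈0 λ vs≈0 → k′ λ { zero → v₀≈0 ; (suc j) → vs≈0 j }
    where
    s g g′ : Carrier
    s = Σ[ (λ j → u j * v (suc j)) ]
    g = s * A zero at₁ + - (v zero * A at₁ at₁ + s * B at₁ at₁)
    g′ = s * B zero at₁
    N≈ : N (v zero) s ≈ g * v zero + Σ[ (λ j → (g′ * u j) * v (suc j)) ]
    N≈ = trans
      (solve 6 (λ x s a b d e → (x :* a :+ s :* b) :* s :+ :- (x :* (x :* d :+ s :* e))
                := (s :* a :+ :- (x :* d :+ s :* e)) :* x :+ (s :* b) :* s) refl
        (v zero) s (A zero at₁) (B zero at₁) (A at₁ at₁) (B at₁ at₁))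
      (+-congˡ (trans (sym (Σ-* g′ (λ j → u j * v (suc j)))) (Σ-cong {k} λ j → sym (*-assoc g′ (u j) (v (suc j))))))

  leftInvertible : LeftInvertible
  leftInvertible {k} v v≢0 with norm v
  ... | u , h with inverse _ (λ eq → h eq v≢0)
  ...   | s , eq = (λ j → s * u j) , trans (Σ-cong {k} (λ j → *-assoc s (u j) (v j)))
            (trans (Σ-* s (λ j → u j * v j)) (trans (*-comm s _) eq))

  -- The component in W of the unit at `(i , i)`, taken along the code; its corner entries are its
  -- coordinates.
  residual : Fin n → Mat n
  residual i k l = unit-matrix (i , i) k l + - combination (proj₁ (project (unit-matrix (i , i)))) k l

  cap : Fin n → Vector 4
  cap i l = uncurry (residual i) (corner l)

  residual-vanishes : ∀ {r} (s : Fin r → Fin n) (a : Fin r → Carrier) →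
    (∀ l → Σ[ (λ i → a i * cap (s i) l) ] ≈ 0#) → ∀ k l → Σ[ (λ i → a i * residual (s i) k l) ] ≈ 0#
  residual-vanishes s a rel k l with classify k l
  ... | at-corner c ≡.refl = rel c
  ... | listed kl∈ = Σ-zero λ i → b≈0⇒ab≈0 (a≈b⇒a-b≈0 (proj₂ (project (unit-matrix (s i , s i))) kl∈))
  ... | below l<k = Σ-zero λ i → b≈0⇒ab≈0 (trans (+-cong (lower (s i)) (-‿cong (upper _ (combination∈ _) k l l<k)))
      (solve 0 (:0 :+ :- :0 := :0) refl))
    where
    lower : ∀ i → unit-matrix (i , i) k l ≈ 0#
    lower i with i Fin.≟ k
    ... | no _ = zeroˡ _
    ... | yes ≡.refl = b≈0⇒ab≈0 (δ-≢ λ k≡l → ℕ.<-irrefl (≡.sym (≡.cong toℕ k≡l)) l<k)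

  -- A relation among the vectors turns the diagonal matrix with entries `a i` at `s i` into a
  -- codeword, and with `r ≤ 3` its weight falls below 4.
  cap-indep : ∀ {r} → r ≤ 3 → (s : Fin r → Fin n) → Injective _≡_ _≡_ s → LinIndep (cap ∘ s)
  cap-indep {r} r≤3 s s-inj = strengthen leftInvertible (cap ∘ s) λ a rel →
    diagonal-sum distance (s≤s r≤3) s s-inj a (diagonal∈ a rel)
    where
    open import Relation.Binary.Reasoning.Setoid setoid
    coefficients : Fin r → Fin t → Carrier
    coefficients i = proj₁ (project (unit-matrix (s i , s i)))
    diagonal∈ : ∀ a → (∀ l → Σ[ (λ i → a i * cap (s i) l) ] ≈ 0#) → C (diagonal (λ l → Σ[ (λ i → a i * δ (s i) l) ]))
    diagonal∈ a rel = respect _ _ (λ k l → sym (eq k l)) (combination∈ (λ q → Σ[ (λ i → a i * coefficients i q) ]))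
      where
      eq : ∀ k l → diagonal (λ l → Σ[ (λ i → a i * δ (s i) l) ]) k l ≈
                   combination (λ q → Σ[ (λ i → a i * coefficients i q) ]) k l
      eq k l = begin
        Σ[ (λ i → a i * δ (s i) k) ] * δ k l
          ≈⟨ trans (*-comm _ _) (sym (Σ-* (δ k l) (λ i → a i * δ (s i) k))) ⟩
        Σ[ (λ i → δ k l * (a i * δ (s i) k)) ]
          ≈⟨ Σ-cong {r} (λ i → trans (diag (a i) (s i)) (sym (solve 3 (λ a e c → :1 :* (a :* (e :+ :- c)) :+ :1 :* (a :* c) := a :* e) refl (a i) (unit-matrix (s i , s i) k l) (combination (coefficients i) k l)))) ⟩
        Σ[ (λ i → 1# * (a i * residual (s i) k l) + 1# * (a i * combination (coefficients i) k l)) ]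
          ≈⟨ Σ-linear 1# 1# (λ i → a i * residual (s i) k l) (λ i → a i * combination (coefficients i) k l) ⟩
        1# * Σ[ (λ i → a i * residual (s i) k l) ] + 1# * Σ[ (λ i → a i * combination (coefficients i) k l) ]
          ≈⟨ +-cong (b≈0⇒ab≈0 (residual-vanishes s a rel k l)) (*-identityˡ _) ⟩
        0# + Σ[ (λ i → a i * combination (coefficients i) k l) ]
          ≈⟨ +-identityˡ _ ⟩
        Σ[ (λ i → a i * combination (coefficients i) k l) ]
          ≈⟨ Σ-cong {r} (λ i → sym (Σ-* (a i) (λ q → coefficients i q * basis q k l))) ⟩
        Σ[ (λ i → Σ[ (λ q → a i * (coefficients i q * basis q k l)) ]) ]
          ≈⟨ Σ-swap (λ i q → a i * (coefficients i q * basis q k l)) ⟩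
        Σ[ (λ q → Σ[ (λ i → a i * (coefficients i q * basis q k l)) ]) ]
          ≈⟨ Σ-cong {t} (λ q → trans (Σ-cong {r} (λ i → solve 3 (λ a c b → a :* (c :* b) := b :* (a :* c)) refl (a i) (coefficients i q) (basis q k l)))
               (trans (Σ-* (basis q k l) (λ i → a i * coefficients i q)) (*-comm _ _))) ⟩
        combination (λ q → Σ[ (λ i → a i * coefficients i q) ]) k l ∎
        where
        diag : ∀ x i → δ k l * (x * δ i k) ≈ x * unit-matrix (i , i) k l
        diag x i with i Fin.≟ k
        ... | no _ = solve 3 (λ x d e → d :* (x :* :0) := x :* (:0 :* e)) refl x _ _
        ... | yes ≡.refl = solve 2 (λ x d → d :* (x :* :1) := x :* (:1 :* d)) refl x _

  isCap : Cap n
  isCap = cap , nonzero , pairs , triples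
    where
    nonzero : ∀ i → ¬ (∀ j → cap i j ≈ 0#)
    nonzero i h = 0≉1 (sym (cap-indep (s≤s z≤n) (λ (_ : Fin 1) → i) (λ { {zero} {zero} _ → ≡.refl })
      (λ _ → 1#) (λ j → trans (+-identityʳ _) (b≈0⇒ab≈0 (h j))) zero))
    pairs : ∀ i j → ¬ (i ≡ j) → LinIndep (pair (cap i) (cap j))
    pairs i j i≢j = cap-indep (s≤s (s≤s z≤n)) s s-inj
      where
      s : Fin 2 → Fin n
      s = i VF.∷ λ _ → j
      s-inj : Injective _≡_ _≡_ s
      s-inj {zero} {zero} _ = ≡.refl
      s-inj {zero} {at₁} eq = contradiction eq i≢j
      s-inj {at₁} {zero} eq = contradiction (≡.sym eq) i≢j
      s-inj {at₁} {at₁} _ = ≡.refl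
    triples : ∀ i j k → ¬ (i ≡ j) → ¬ (j ≡ k) → ¬ (i ≡ k) → LinIndep (triple (cap i) (cap j) (cap k))
    triples i j k i≢j j≢k i≢k = cap-indep ℕ.≤-refl s s-inj
      where
      s : Fin 3 → Fin n
      s = i VF.∷ j VF.∷ λ _ → k
      s-inj : Injective _≡_ _≡_ s
      s-inj {zero} {zero} _ = ≡.refl
      s-inj {zero} {at₁} eq = contradiction eq i≢j
      s-inj {zero} {at₂} eq = contradiction eq i≢k
      s-inj {at₁} {zero} eq = contradiction (≡.sym eq) i≢j
      s-inj {at₁} {at₁} _ = ≡.refl
      s-inj {at₁} {at₂} eq = contradiction eq j≢k
      s-inj {at₂} {zero} eq = contradiction (≡.sym eq) i≢k
      s-inj {at₂} {at₁} eq = contradiction (≡.sym eq) j≢k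
      s-inj {at₂} {at₂} _ = ≡.refl

-- Projective geometry over a finite field.

-- Finite fields have decidable equality, so from here on the argument is classical.
module FiniteField {c ℓ} (F : Field c ℓ) {q : ℕ} (card : LinearAlgebra.HasCardinality F q) where
  open Field F hiding (zero)
  open LinearAlgebra F
  open FiniteSums F
  open ℤ-Coefficients commutativeRing
  open import Relation.Binary.Reasoning.Setoid setoid

  element : Fin q → Carrier
  element = proj₁ card

  element-injective : ∀ i j → element i ≈ element j → i ≡ j
  element-injective = proj₁ (proj₂ card)

  index : Carrier → Fin q
  index x = proj₁ (proj₂ (proj₂ card) x)

  element-index : ∀ x → element (index x) ≈ x
  element-index x = proj₂ (proj₂ (proj₂ card) x)

  infix 4 _≈?_
  _≈?_ : ∀ x y → Dec (x ≈ y)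
  x ≈? y = map′
    (λ eq → trans (sym (element-index x)) (trans (reflexive (≡.cong element eq)) (element-index y)))
    (λ x≈y → element-injective _ _ (trans (element-index x) (trans x≈y (sym (element-index y)))))
    (index x Fin.≟ index y)

  ∃-element? : ∀ {p} {P : Carrier → Set p} → (∀ {x y} → x ≈ y → P x → P y) → (∀ x → Dec (P x)) → Dec (∃ P)
  ∃-element? resp P? = map′ (λ (i , p) → element i , p) (λ (x , p) → index x , resp (sym (element-index x)) p)
    (Fin.any? (P? ∘ element))

  module _ {m : ℕ} where
    infix 4 _≐_ _∥_ _∈⟨_,_⟩

    _≐_ : Vector m → Vector m → Set ℓ
    u ≐ v = ∀ j → u j ≈ v j

    Zero : Vector m → Set ℓ
    Zero v = ∀ j → v j ≈ 0#

    lc : Carrier → Vector m → Carrier → Vector m → Vector m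
    lc a u b v j = a * u j + b * v j

    -- The scalar may be 0, so the zero vector is a multiple of everything and symmetry asks for `u`
    -- nonzero.
    _∥_ : Vector m → Vector m → Set (c ⊔ ℓ)
    u ∥ v = ∃ λ a → ∀ j → u j ≈ a * v j

    _∈⟨_,_⟩ : Vector m → Vector m → Vector m → Set (c ⊔ ℓ)
    u ∈⟨ x , y ⟩ = ∃₂ λ a b → u ≐ lc a x b y

    _∥?_ : ∀ u v → Dec (u ∥ v)
    u ∥? v = ∃-element? (λ a≈b h j → trans (h j) (*-congʳ a≈b)) (λ a → Fin.all? (λ j → u j ≈? a * v j))

    _∈?⟨_,_⟩ : ∀ u x y → Dec (u ∈⟨ x , y ⟩)
    u ∈?⟨ x , y ⟩ = ∃-element? (λ a≈a′ (b , h) → b , λ j → trans (h j) (+-congʳ (*-congʳ a≈a′)))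
      (λ a → ∃-element? (λ b≈b′ h j → trans (h j) (+-congˡ (*-congʳ b≈b′)))
        (λ b → Fin.all? (λ j → u j ≈? a * x j + b * y j)))

    ∥-refl : ∀ {u} → u ∥ u
    ∥-refl = 1# , λ j → sym (*-identityˡ _)

    ∥-trans : ∀ {u v w} → u ∥ v → v ∥ w → u ∥ w
    ∥-trans (a , h) (b , h′) = a * b , λ j → trans (h j) (trans (*-congˡ (h′ j)) (sym (*-assoc a b _)))

    ∥-scalar≢0 : ∀ {u v} → ¬ Zero u → (u∥v : u ∥ v) → ¬ (proj₁ u∥v ≈ 0#)
    ∥-scalar≢0 u≢0 (a , h) a≈0 = u≢0 λ j → trans (h j) (a≈0⇒ab≈0 a≈0)

    ∥-sym : ∀ {u v} → ¬ Zero u → u ∥ v → v ∥ u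
    ∥-sym {v = v} u≢0 u∥v@(a , h) with inverse a (∥-scalar≢0 u≢0 u∥v)
    ... | b , ab≈1 = b , λ j → sym (trans (*-congˡ (h j)) (trans (solve 3 (λ a b x → b :* (a :* x) := a :* b :* x) refl a b (v j))
            (trans (*-congʳ ab≈1) (*-identityˡ _))))

    Zero-∥ : ∀ {u v} → Zero u → u ∥ v
    Zero-∥ u≈0 = 0# , λ j → trans (u≈0 j) (sym (zeroˡ _))

    ∥-Zero : ∀ {u v} → u ∥ v → Zero v → Zero u
    ∥-Zero (a , h) v≈0 j = trans (h j) (b≈0⇒ab≈0 (v≈0 j))

    ∥⇒∈ : ∀ {u x y} → u ∥ x → u ∈⟨ x , y ⟩
    ∥⇒∈ {x = x} {y} (a , h) = a , 0# , λ j → trans (h j) (solve 3 (λ a x y → a :* x := a :* x :+ :0 :* y) refl a (x j) (y j))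

    ∈-left : ∀ {x y} → x ∈⟨ x , y ⟩
    ∈-left = ∥⇒∈ ∥-refl

    ∈-comm : ∀ {u x y} → u ∈⟨ x , y ⟩ → u ∈⟨ y , x ⟩
    ∈-comm (a , b , h) = b , a , λ j → trans (h j) (+-comm _ _)

    ∈-right : ∀ {x y} → y ∈⟨ x , y ⟩
    ∈-right = ∈-comm ∈-left

    ∈-diagonal : ∀ {u x} → u ∈⟨ x , x ⟩ → u ∥ x
    ∈-diagonal (a , b , h) = a + b , λ j → trans (h j) (sym (distribʳ _ a b))

    ∈-trans : ∀ {u x y v w} → u ∈⟨ x , y ⟩ → x ∈⟨ v , w ⟩ → y ∈⟨ v , w ⟩ → u ∈⟨ v , w ⟩
    ∈-trans {v = v} {w} (a , b , h) (c , d , hx) (e , f , hy) = a * c + b * e , a * d + b * f , λ j →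
      trans (h j) (trans (+-cong (*-congˡ (hx j)) (*-congˡ (hy j)))
        (solve 8 (λ a b c d e f v w → a :* (c :* v :+ d :* w) :+ b :* (e :* v :+ f :* w)
                  := (a :* c :+ b :* e) :* v :+ (a :* d :+ b :* f) :* w) refl a b c d e f (v j) (w j)))

    ∈-Zero : ∀ {u x y} → u ∈⟨ x , y ⟩ → Zero y → u ∥ x
    ∈-Zero (a , b , h) y≈0 = a , λ j → trans (h j) (trans (+-congˡ (b≈0⇒ab≈0 (y≈0 j))) (+-identityʳ _))

    independent : ∀ {x y a b} → ¬ Zero x → ¬ y ∥ x → Zero (lc a x b y) → a ≈ 0# × b ≈ 0#
    independent {x} {y} {a} {b} x≢0 y∦x h with b ≈? 0#
    ... | yes b≈0 = decidable-stable (a ≈? 0#) (λ a≉0 → x≢0 λ j → x≈0 a≉0 j) , b≈0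
      where
      x≈0 : ¬ (a ≈ 0#) → ∀ j → x j ≈ 0#
      x≈0 a≉0 j with inverse a a≉0
      ... | a′ , aa′≈1 = begin
        x j                          ≈⟨ trans (sym (*-identityˡ _)) (*-congʳ (sym aa′≈1)) ⟩
        a * a′ * x j                 ≈⟨ solve 3 (λ a a′ x → a :* a′ :* x := a′ :* (a :* x)) refl a a′ (x j) ⟩
        a′ * (a * x j)               ≈⟨ b≈0⇒ab≈0 (trans (sym (trans (+-congˡ (a≈0⇒ab≈0 b≈0)) (+-identityʳ _))) (h j)) ⟩
        0#                           ∎
    ... | no b≉0 with inverse b b≉0
    ...   | b′ , bb′≈1 = contradiction (- (b′ * a) , λ j → begin
        y j                                          ≈⟨ trans (sym (*-identityˡ _)) (*-congʳ (sym bb′≈1)) ⟩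
        b * b′ * y j
          ≈⟨ solve 5 (λ a b b′ x y → b :* b′ :* y := b′ :* (a :* x :+ b :* y) :+ :- (b′ :* a) :* x) refl a b b′ (x j) (y j) ⟩
        b′ * (a * x j + b * y j) + - (b′ * a) * x j  ≈⟨ trans (+-congʳ (b≈0⇒ab≈0 (h j))) (+-identityˡ _) ⟩
        - (b′ * a) * x j                             ∎) y∦x

    -- Steinitz exchange: the coefficient of `x` cannot vanish, so the equation can be solved for
    -- `x`.
    exchange : ∀ {u x y} → u ∈⟨ x , y ⟩ → ¬ u ∥ y → x ∈⟨ u , y ⟩
    exchange {u} {x} {y} (a , b , h) u∦y with a ≈? 0#
    ... | yes a≈0 = contradiction (b , λ j → trans (h j) (trans (+-congʳ (a≈0⇒ab≈0 a≈0)) (+-identityˡ _))) u∦y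
    ... | no a≉0 with inverse a a≉0
    ...   | a′ , aa′≈1 = a′ , - (a′ * b) , λ j → sym (begin
      a′ * u j + - (a′ * b) * y j              ≈⟨ +-congʳ (*-congˡ (h j)) ⟩
      a′ * (a * x j + b * y j) + - (a′ * b) * y j
        ≈⟨ solve 5 (λ a a′ b x y → a′ :* (a :* x :+ b :* y) :+ :- (a′ :* b) :* y := a :* a′ :* x) refl a a′ b (x j) (y j) ⟩
      a * a′ * x j                             ≈⟨ trans (*-congʳ aa′≈1) (*-identityˡ _) ⟩
      x j                                      ∎)

  record Linear (m n : ℕ) : Set (c ⊔ ℓ) where
    field
      map : Vector m → Vector n
      map-cong : ∀ {u v} → u ≐ v → map u ≐ map v
      map-lc : ∀ a u b v → map (lc a u b v) ≐ lc a (map u) b (map v)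

    map-∥ : ∀ {u v} → u ∥ v → map u ∥ map v
    map-∥ {u} {v} (a , h) = ∈-diagonal (a , 0# , λ j → trans
      (map-cong {v = lc a v 0# v} (λ i → trans (h i) (solve 2 (λ a v → a :* v := a :* v :+ :0 :* v) refl a (v i))) j)
      (map-lc a v 0# v j))

    map-∈ : ∀ {u x y} → u ∈⟨ x , y ⟩ → map u ∈⟨ map x , map y ⟩
    map-∈ (a , b , h) = a , b , λ j → trans (map-cong h j) (map-lc a _ b _ j)

  _∘ᴸ_ : ∀ {l m n} → Linear m n → Linear l m → Linear l n
  g ∘ᴸ f = record
    { map = G.map ∘ L.map
    ; map-cong = G.map-cong ∘ L.map-cong
    ; map-lc = λ a u b v j → trans (G.map-cong (L.map-lc a u b v) j) (G.map-lc a _ b _ j)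
    }
    where
    module G = Linear g
    module L = Linear f

  -- Projection from the point `v`: points of the target are lines through `v`, and `lift` realises
  -- each of them.
  record Quotient {m} (v : Vector (suc m)) : Set (c ⊔ ℓ) where
    field
      linear : Linear (suc m) m
    open Linear linear public
    field
      vanishes : Zero (map v)
      kernel : ∀ {x} → Zero (map x) → x ∥ v
      lift : ∀ y → ∃ λ x → map x ≐ y

  opaque
    quotient : ∀ {m} (v : Vector (suc m)) → ¬ Zero v → Quotient v
    quotient {m} v v≢0 = from-pivot (Fin.¬∀⟶∃¬ _ _ (λ j → v j ≈? 0#) v≢0)
      where
      from-pivot : (∃ λ j → ¬ (v j ≈ 0#)) → Quotient v
      from-pivot (j , vj≢0) = record
        { linear = record
          { map = proj
          ; map-cong = λ h i → +-cong (h _) (-‿cong (*-congʳ (h j)))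
          ; map-lc = λ a x b y i → solve 7 (λ a x b y z xj yj →
              (a :* x :+ b :* y) :+ :- ((a :* xj :+ b :* yj) :* z)
                := a :* (x :+ :- (xj :* z)) :+ b :* (y :+ :- (yj :* z))) refl a (x (punchIn j i)) b (y (punchIn j i)) (v⁻¹ * v (punchIn j i)) (x j) (y j)
          }
        ; vanishes = λ i → trans (solve 3 (λ x y v′ → x :+ :- (y :* (v′ :* x)) := x :* (:1 :+ :- (y :* v′))) refl (v (punchIn j i)) (v j) v⁻¹)
            (b≈0⇒ab≈0 (trans (+-congˡ (-‿cong eq)) (-‿inverseʳ 1#)))
        ; kernel = λ {x} h → x j * v⁻¹ , λ i → coordinate x h i (j Fin.≟ i)
        ; lift = λ y → VF.insertAt y j 0# , λ i → trans
            (+-cong (reflexive (insertAt-punchIn y j 0# i)) (-‿cong (a≈0⇒ab≈0 (reflexive (insertAt-lookup y j 0#)))))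
            (solve 1 (λ y → y :+ :- :0 := y) refl (y i))
        }
        where
        v⁻¹ : Carrier
        v⁻¹ = proj₁ (inverse (v j) vj≢0)
        eq : v j * v⁻¹ ≈ 1#
        eq = proj₂ (inverse (v j) vj≢0)
        proj : Vector (suc m) → Vector m
        proj x i = x (punchIn j i) + - (x j * (v⁻¹ * v (punchIn j i)))
        coordinate : ∀ x → Zero (proj x) → ∀ i → Dec (j ≡ i) → x i ≈ x j * v⁻¹ * v i
        coordinate x h i (yes ≡.refl) = sym (trans (solve 3 (λ x v v′ → x :* v′ :* v := x :* (v :* v′)) refl (x j) (v j) v⁻¹)
          (trans (*-congˡ eq) (*-identityʳ _)))
        coordinate x h i (no j≢i) = ≡.subst (λ i → x i ≈ x j * v⁻¹ * v i) (Fin.punchIn-punchOut j≢i)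
          (trans (a-b≈0⇒a≈b (h (punchOut j≢i))) (sym (*-assoc _ _ _)))

  -- Projection from the line through `x` and `y`. In `F^4` the target is a projective line whose
  -- points are the planes through that line.
  record Pencil {m} (x y : Vector (suc (suc m))) : Set (c ⊔ ℓ) where
    field
      linear : Linear (suc (suc m)) m
    open Linear linear public
    field
      vanishes : ∀ {u} → u ∈⟨ x , y ⟩ → Zero (map u)
      kernel : ∀ {u} → Zero (map u) → u ∈⟨ x , y ⟩
      lift : ∀ v → ∃ λ u → map u ≐ v

  opaque
    pencil : ∀ {m} (x y : Vector (suc (suc m))) → ¬ Zero x → ¬ y ∥ x → Pencil x y
    pencil x y x≢0 y∦x = record
      { linear = R.linear ∘ᴸ Q.linear
      ; vanishes = λ u∈ → ∥-Zero (R.map-∥ (∈-diagonal (∈-trans (Q.map-∈ u∈) (∥⇒∈ (Zero-∥ Q.vanishes)) ∈-left))) R.vanishes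
      ; kernel = λ {u} h → from-ker (R.kernel h)
      ; lift = λ v → let (w , hw) = R.lift v ; (u , hu) = Q.lift w in u , λ j → trans (R.map-cong hu j) (hw j)
      }
      where
      module Q = Quotient (quotient x x≢0)
      module R = Quotient (quotient (Q.map y) (y∦x ∘ Q.kernel))
      from-ker : ∀ {u} → Q.map u ∥ Q.map y → u ∈⟨ x , y ⟩
      from-ker {u} (a , h) with Q.kernel {lc 1# u (- a) y} (λ j → trans (Q.map-lc 1# u (- a) y j)
        (trans (+-congʳ (*-congˡ (h j))) (solve 2 (λ a z → :1 :* (a :* z) :+ :- a :* z := :0) refl a (Q.map y j))))
      ... | b , h′ = b , a , λ j → trans (solve 3 (λ u a y → u := (:1 :* u :+ :- a :* y) :+ a :* y) refl (u j) a (y j)) (+-congʳ (h′ j))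

  -- Representatives of the points of the projective space of F^m.
  record Points (m θ : ℕ) : Set (c ⊔ ℓ) where
    field
      point : Fin θ → Vector m
      point≢0 : ∀ i → ¬ Zero (point i)
      point-distinct : ∀ {i j} → point i ∥ point j → i ≡ j
      locate : ∀ v → ¬ Zero v → ∃ λ i → v ∥ point i

    Spread : ∀ s → (Fin s → Vector m) → Set (c ⊔ ℓ)
    Spread s f = (∀ i → ¬ Zero (f i)) × (∀ i j → i ≢ j → ¬ f i ∥ f j)

    spread-∷ : ∀ {s f v} → ¬ Zero v → (∀ i → ¬ f i ∥ v) → Spread s f → Spread (suc s) (v VF.∷ f)
    spread-∷ {s} {f} {v} v≢0 f∦v (f≢0 , f-spread) = nz , sp
      where
      nz : ∀ i → ¬ Zero ((v VF.∷ f) i)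
      nz zero = v≢0
      nz (suc i) = f≢0 i
      sp : ∀ i j → i ≢ j → ¬ (v VF.∷ f) i ∥ (v VF.∷ f) j
      sp zero zero i≢j _ = i≢j ≡.refl
      sp zero (suc j) _ v∥f = f∦v j (∥-sym v≢0 v∥f)
      sp (suc i) zero _ f∥v = f∦v i f∥v
      sp (suc i) (suc j) i≢j = f-spread i j (i≢j ∘ ≡.cong suc)

    spread-bound : ∀ {s f} → Spread s f → s ≤ θ
    spread-bound {s} {f} (f≢0 , f-spread) = Fin.injective⇒≤ {f = λ i → proj₁ (locate (f i) (f≢0 i))} inj
      where
      inj : ∀ {i j} → proj₁ (locate (f i) (f≢0 i)) ≡ proj₁ (locate (f j) (f≢0 j)) → i ≡ j
      inj {i} {j} eq = decidable-stable (i Fin.≟ j) λ i≢j → f-spread i j i≢j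
        (∥-trans (≡.subst (λ k → f i ∥ point k) eq (proj₂ (locate (f i) (f≢0 i)))) (∥-sym (f≢0 j) (proj₂ (locate (f j) (f≢0 j)))))

    -- A missed point could be added to the spread, which would then exceed the total number `θ` of
    -- points.
    spread-onto : ∀ {f} → Spread θ f → ∀ {v} → ¬ Zero v → ∃ λ i → f i ∥ v
    spread-onto {f} sp {v} v≢0 with Fin.any? (λ i → f i ∥? v)
    ... | yes hit = hit
    ... | no miss = contradiction (spread-bound (spread-∷ v≢0 (λ i h → miss (i , h)) sp)) ℕ.1+n≰n

    missed-point : ∀ {s} (f : Fin s → Vector m) → s < θ → ∃ λ i → ∀ j → ¬ point i ∥ f j
    missed-point {s} f s<θ with Fin.all? (λ i → Fin.any? (λ j → point i ∥? f j))
    ... | no ¬all = let (i , h) = Fin.¬∀⟶∃¬ θ _ (λ i → Fin.any? (λ j → point i ∥? f j)) ¬all in i , λ j p → h (j , p)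
    ... | yes all = contradiction (Fin.injective⇒≤ {f = proj₁ ∘ all} inj) (ℕ.<⇒≱ s<θ)
      where
      inj : ∀ {i i′} → proj₁ (all i) ≡ proj₁ (all i′) → i ≡ i′
      inj {i} {i′} eq = point-distinct (∥-trans (proj₂ (all i))
        (∥-sym (point≢0 i′) (≡.subst (λ j → point i′ ∥ f j) (≡.sym eq) (proj₂ (all i′)))))

  record AllVectors (m Q : ℕ) : Set (c ⊔ ℓ) where
    field
      vector : Fin Q → Vector m
      vector-distinct : ∀ {i j} → vector i ≐ vector j → i ≡ j
      find : ∀ v → ∃ λ i → vector i ≐ v

  scalars : AllVectors 1 q
  scalars = record
    { vector = λ i _ → element i
    ; vector-distinct = λ h → element-injective _ _ (h zero)
    ; find = λ v → index (v zero) , λ { zero → element-index (v zero) }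
    }

  planar : AllVectors 2 (q ℕ.* q)
  planar = record
    { vector = λ i → element (proj₁ (Fin.remQuot {q} q i)) VF.∷ element (proj₂ (Fin.remQuot {q} q i)) VF.∷ VF.[]
    ; vector-distinct = λ {i} {j} h → ≡.trans (≡.sym (Fin.combine-remQuot {q} q i)) (≡.trans
        (≡.cong₂ Fin.combine (element-injective _ _ (h zero)) (element-injective _ _ (h (suc zero)))) (Fin.combine-remQuot {q} q j))
    ; find = λ v → Fin.combine (index (v zero)) (index (v (suc zero))) , λ
        { zero → trans (reflexive (≡.cong (element ∘ proj₁) (Fin.remQuot-combine {q} {q} (index (v zero)) (index (v (suc zero)))))) (element-index _)
        ; (suc zero) → trans (reflexive (≡.cong (element ∘ proj₂) (Fin.remQuot-combine {q} {q} (index (v zero)) (index (v (suc zero)))))) (element-index _) }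
    }

  single-point : Points 1 1
  single-point = record
    { point = λ _ _ → 1#
    ; point≢0 = λ _ h → 0≉1 (sym (h zero))
    ; point-distinct = λ { {zero} {zero} _ → ≡.refl }
    ; locate = λ v _ → zero , v zero , λ { zero → sym (*-identityʳ _) }
    }

  -- An affine chart, with first coordinate 1, together with the hyperplane at infinity, with first
  -- coordinate 0.
  extend-points : ∀ {m Q θ} → AllVectors m Q → Points m θ → Points (suc m) (Q ℕ.+ θ)
  extend-points {m} {Q} {θ} vs ps = record
    { point = λ i → pt (Fin.splitAt Q i)
    ; point≢0 = λ i → pt≢0 (Fin.splitAt Q i)
    ; point-distinct = λ {i} {j} h → ≡.trans (≡.sym (Fin.join-splitAt Q θ i))
        (≡.trans (≡.cong (Fin.join Q θ) (pt-distinct (Fin.splitAt Q i) (Fin.splitAt Q j) h)) (Fin.join-splitAt Q θ j))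
    ; locate = λ v v≢0 → let (s , h) = loc v v≢0 in
        Fin.join Q θ s , ≡.subst (λ s → v ∥ pt s) (≡.sym (Fin.splitAt-join Q θ s)) h
    }
    where
    open AllVectors vs
    open Points ps
    pt : Fin Q ⊎ Fin θ → Vector (suc m)
    pt (inj₁ i) = 1# VF.∷ vector i
    pt (inj₂ i) = 0# VF.∷ point i
    pt≢0 : ∀ s → ¬ Zero (pt s)
    pt≢0 (inj₁ i) h = 0≉1 (sym (h zero))
    pt≢0 (inj₂ i) h = point≢0 i (h ∘ suc)
    pt-distinct : ∀ s s′ → pt s ∥ pt s′ → s ≡ s′
    pt-distinct (inj₁ i) (inj₁ j) (a , h) = ≡.cong inj₁ (vector-distinct λ l → trans (h (suc l))
      (trans (*-congʳ (trans (sym (*-identityʳ a)) (sym (h zero)))) (*-identityˡ _)))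
    pt-distinct (inj₁ i) (inj₂ j) (a , h) = contradiction (sym (trans (h zero) (zeroʳ a))) 0≉1
    pt-distinct (inj₂ i) (inj₁ j) (a , h) = contradiction
      (λ l → trans (h (suc l)) (a≈0⇒ab≈0 (trans (sym (*-identityʳ a)) (sym (h zero))))) (point≢0 i)
    pt-distinct (inj₂ i) (inj₂ j) (a , h) = ≡.cong inj₂ (point-distinct (a , h ∘ suc))
    loc : ∀ v → ¬ Zero v → ∃ λ s → v ∥ pt s
    loc v v≢0 with v zero ≈? 0#
    ... | yes v₀≈0 = let (i , a , h) = locate (v ∘ suc) (λ t≈0 → v≢0 λ { zero → v₀≈0 ; (suc j) → t≈0 j }) in
      inj₂ i , a , λ { zero → trans v₀≈0 (sym (zeroʳ a)) ; (suc j) → h j }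
    ... | no v₀≉0 = let (b , eq) = inverse (v zero) v₀≉0 ; (i , h) = find (λ j → b * v (suc j)) in
      inj₁ i , v zero , λ { zero → sym (*-identityʳ _)
        ; (suc j) → sym (trans (*-congˡ (h j)) (trans (sym (*-assoc _ _ _)) (trans (*-congʳ eq) (*-identityˡ _)))) }

  opaque
    line-points : Points 2 (suc q)
    line-points = ≡.subst (Points 2) (ℕ.+-comm q 1) (extend-points scalars single-point)

    plane-points : Points 3 (q ℕ.* q ℕ.+ suc q)
    plane-points = extend-points planar line-points

-- Counting in finite sets.

record Distinct {a k} (r : ℕ) (Q : Fin k → Set a) : Set a where
  field
    to : Fin r → Fin k
    to-injective : Injective _≡_ _≡_ to
    holds : ∀ j → Q (to j)

  -- `Distinct r Q` alone says at least `r`; with this condition the count is exact.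
  Exhaustive : Set a
  Exhaustive = ∀ l → Q l → ∃ λ j → to j ≡ l

open Distinct

everything : ∀ {k} → Distinct {k = k} k (λ _ → ⊤)
everything = record { to = id ; to-injective = id ; holds = λ _ → tt }

module _ {a k} {Q : Fin k → Set a} where

  map-holds : ∀ {b r} {R : Fin k → Set b} → (∀ i → Q i → R i) → Distinct r Q → Distinct r R
  map-holds f d = record { to = to d ; to-injective = to-injective d ; holds = λ j → f _ (holds d j) }

  take : ∀ {r s} → r ≤ s → Distinct s Q → Distinct r Q
  take r≤s d = record
    { to = λ j → to d (Fin.inject≤ j r≤s)
    ; to-injective = λ eq → Fin.inject≤-injective r≤s r≤s _ _ (to-injective d eq)
    ; holds = λ j → holds d _
    }

  bounded : ∀ {r} → Distinct r Q → r ≤ k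
  bounded d = Fin.injective⇒≤ (to-injective d)

  extend : ∀ {r} (d : Distinct r Q) l → Q l → (∀ j → to d j ≢ l) → Distinct (suc r) Q
  extend d l Ql l∉ = record { to = l VF.∷ to d ; to-injective = inj ; holds = λ { zero → Ql ; (suc j) → holds d j } }
    where
    inj : Injective _≡_ _≡_ (l VF.∷ to d)
    inj {zero} {zero} _ = ≡.refl
    inj {zero} {suc j} eq = contradiction (≡.sym eq) (l∉ j)
    inj {suc i} {zero} eq = contradiction eq (l∉ i)
    inj {suc i} {suc j} eq = ≡.cong suc (to-injective d eq)

  exhaustive : ∀ {r} → ¬ Distinct (suc r) Q → (d : Distinct r Q) → Exhaustive d
  exhaustive no-more d l Ql with Fin.any? (λ j → to d j Fin.≟ l)
  ... | yes hit = hit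
  ... | no miss = contradiction (extend d l Ql (λ j eq → miss (j , eq))) no-more

  remove : ∀ {r} (d : Distinct (suc r) Q) j → Distinct r (λ i → Q i × i ≢ to d j)
  remove d j = record
    { to = to d ∘ punchIn j
    ; to-injective = Fin.punchIn-injective j _ _ ∘ to-injective d
    ; holds = λ i → holds d _ , Fin.punchInᵢ≢i j i ∘ to-injective d
    }

  remove-exhaustive : ∀ {r} (d : Distinct (suc r) Q) j → Exhaustive d → Exhaustive (remove d j)
  remove-exhaustive d j exh l (Ql , l≢) with exh l Ql
  ... | i , ≡.refl = punchOut {i = j} {j = i} (l≢ ∘ ≡.cong (to d) ∘ ≡.sym) , ≡.cong (to d) (Fin.punchIn-punchOut _)

  avoid : ∀ {r} → Distinct (suc r) Q → ∀ l → Distinct r (λ i → Q i × i ≢ l)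
  avoid d l with Fin.any? (λ j → to d j Fin.≟ l)
  ... | yes (j , ≡.refl) = remove d j
  ... | no miss = record
    { to = to d ∘ suc
    ; to-injective = Fin.suc-injective ∘ to-injective d
    ; holds = λ j → holds d _ , λ eq → miss (suc j , eq)
    }

fibre-size : ∀ {s m} → (Fin s → Fin m) → Fin m → ℕ
fibre-size c y = sumℕ (λ j → count-≡ (c j) y)

fibre : ∀ {s m} (c : Fin s → Fin m) y → Σ (Distinct (fibre-size c y) (λ j → c j ≡ y)) Exhaustive
fibre {zero} c y = record { to = λ () ; to-injective = λ { {()} } ; holds = λ () } , λ ()
fibre {suc s} c y with c zero Fin.≟ y | fibre (c ∘ suc) y
... | yes eq | d , exh =
  extend (record { to = suc ∘ to d ; to-injective = to-injective d ∘ Fin.suc-injective ; holds = holds d }) zero eq (λ _ ()) ,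
  λ { zero _ → zero , ≡.refl ; (suc l) h → let (j , eq) = exh l h in suc j , ≡.cong suc eq }
... | no neq | d , exh =
  record { to = suc ∘ to d ; to-injective = to-injective d ∘ Fin.suc-injective ; holds = holds d } ,
  λ { zero h → contradiction h neq ; (suc l) h → let (j , eq) = exh l h in j , ≡.cong suc eq }

-- Otherwise the fibres, whose sizes sum to `s`, would have at most `m r` elements in all.
crowded-fibre : ∀ {s m r} → m ℕ.* r < s → (c : Fin s → Fin m) → ∃ λ y → Distinct (suc r) (λ j → c j ≡ y)
crowded-fibre {s} {m} {r} mr<s c with Fin.all? (λ y → fibre-size c y ℕ.≤? r)
... | yes all≤ = contradiction
  (≡.subst₂ _≤_ (sumℕ-multiplicity c) (sumℕ-const m r) (sumℕ-mono all≤)) (ℕ.<⇒≱ mr<s)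
... | no ¬all = let (y , ≰r) = Fin.¬∀⟶∃¬ m _ (λ y → fibre-size c y ℕ.≤? r) ¬all in
  y , take (ℕ.≰⇒> ≰r) (proj₁ (fibre c y))

injective⇒surjective : ∀ {n} (f : Fin n → Fin n) → Injective _≡_ _≡_ f → ∀ y → ∃ λ x → f x ≡ y
injective⇒surjective {n} f f-inj y with Fin.any? (λ x → f x Fin.≟ y)
... | yes hit = hit
injective⇒surjective {suc n} f f-inj y | no miss =
  contradiction (Fin.injective⇒≤ {f = λ x → punchOut {i = y} {j = f x} (λ eq → miss (x , ≡.sym eq))}
    (λ {i} {j} eq → f-inj (Fin.punchOut-injective {i = y} {j = f i} {k = f j} _ _ eq))) ℕ.1+n≰n

-- The points i with i < σ i and those with σ i < i are exchanged by σ.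
fixpoint-free-involution-even : ∀ {n} (σ : Fin n → Fin n) → (∀ i → σ i ≢ i) → (∀ i → σ (σ i) ≡ i) → ∃ λ h → n ≡ h ℕ.+ h
fixpoint-free-involution-even {n} σ σ≢ σσ = sum ascents , (begin
  n                                             ≡⟨ ≡.sym (sum-ones n) ⟩
  sum {n} (λ _ → 1)                             ≡⟨ sum-cong-≗ {n} (λ i → ≡.sym (split i)) ⟩
  sum (λ i → ascents i ℕ.+ ascents (σ i))       ≡⟨ ∑-distrib-+ ascents (ascents ∘ σ) ⟩
  sum ascents ℕ.+ sum (ascents ∘ σ)             ≡⟨ ≡.cong (sum ascents ℕ.+_) (≡.sym (sum-permute ascents (permutation σ σ σσ σσ))) ⟩
  sum ascents ℕ.+ sum ascents                   ∎)
  where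
  open import Algebra.Properties.CommutativeMonoid.Sum ℕ.+-0-commutativeMonoid
  open ≡.≡-Reasoning
  less : Fin n → Fin n → ℕ
  less i j with i Fin.<? j
  ... | yes _ = 1
  ... | no _ = 0
  ascents : Fin n → ℕ
  ascents i = less i (σ i)
  sum-ones : ∀ k → sum {k} (λ _ → 1) ≡ k
  sum-ones zero = ≡.refl
  sum-ones (suc k) = ≡.cong suc (sum-ones k)
  trichotomy : ∀ i j → i ≢ j → less i j ℕ.+ less j i ≡ 1
  trichotomy i j i≢j with i Fin.<? j | j Fin.<? i
  ... | yes i<j | yes j<i = contradiction j<i (ℕ.<-asym i<j)
  ... | yes _ | no _ = ≡.refl
  ... | no _ | yes _ = ≡.refl
  ... | no i≮j | no j≮i = contradiction (Fin.toℕ-injective (ℕ.≤-antisym (ℕ.≮⇒≥ j≮i) (ℕ.≮⇒≥ i≮j))) i≢j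
  split : ∀ i → ascents i ℕ.+ ascents (σ i) ≡ 1
  split i = ≡.trans (≡.cong (λ k → less i (σ i) ℕ.+ less (σ i) k) (σσ i)) (trichotomy i (σ i) (σ≢ i ∘ ≡.sym))

consecutive-not-both-even : ∀ {n} → (∃ λ h → n ≡ h ℕ.+ h) → ¬ (∃ λ h → suc n ≡ h ℕ.+ h)
consecutive-not-both-even (h , ≡.refl) (h′ , eq) = go h h′ eq
  where
  go : ∀ h h′ → suc (h ℕ.+ h) ≢ h′ ℕ.+ h′
  go h zero ()
  go zero (suc h′) eq = case ≡.trans (ℕ.suc-injective eq) (ℕ.+-suc h′ h′) of λ ()
  go (suc h) (suc h′) eq = go h h′ (ℕ.suc-injective (ℕ.suc-injective
    (≡.trans (≡.cong (λ x → suc (suc x)) (≡.sym (ℕ.+-suc h h))) (≡.trans eq (≡.cong suc (ℕ.+-suc h′ h′))))))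

-- Plane sections and secants of a cap.

module CapGeometry {c ℓ} (F : Field c ℓ) {q : ℕ} (card : LinearAlgebra.HasCardinality F q) where
  open Field F hiding (zero)
  open LinearAlgebra F
  open FiniteSums F
  open FiniteField F card
  open ℤ-Coefficients commutativeRing
  module ℓᵖ = Points line-points
  module πᵖ = Points plane-points

  det : Vector 2 → Vector 2 → Carrier
  det p x = p (suc zero) * x zero + - (p zero * x (suc zero))

  ∥⇒det≈0 : ∀ {p x} → x ∥ p → det p x ≈ 0#
  ∥⇒det≈0 {p} {x} (a , h) = trans (+-cong (*-congˡ (h zero)) (-‿cong (*-congˡ (h (suc zero)))))
    (solve 3 (λ a p₀ p₁ → p₁ :* (a :* p₀) :+ :- (p₀ :* (a :* p₁)) := :0) refl a (p zero) (p (suc zero)))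

  det≈0⇒∥ : ∀ {p x} → ¬ Zero p → det p x ≈ 0# → x ∥ p
  det≈0⇒∥ {p} {x} p≢0 d with Fin.¬∀⟶∃¬ 2 _ (λ j → p j ≈? 0#) p≢0
  ... | j , pj≉0 with inverse (p j) pj≉0
  ...   | r , eq = x j * r , λ i → sym (trans (solve 3 (λ x r p → x :* r :* p := r :* (p :* x)) refl (x j) r (p i))
          (trans (*-congˡ (cross j i)) (trans (solve 3 (λ r p x → r :* (p :* x) := p :* r :* x) refl r (p j) (x i))
            (trans (*-congʳ eq) (*-identityˡ _)))))
    where
    cross : ∀ j i → p i * x j ≈ p j * x i
    cross zero zero = refl
    cross zero (suc zero) = a-b≈0⇒a≈b d
    cross (suc zero) zero = sym (a-b≈0⇒a≈b d)
    cross (suc zero) (suc zero) = refl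

  record Plane : Set (c ⊔ ℓ) where
    field
      form : Vector 4 → Carrier
      form-cong : ∀ {u v} → u ≐ v → form u ≈ form v
      form-lc : ∀ a u b v → form (lc a u b v) ≈ a * form u + b * form v
      apex : Vector 4
      apex∉ : ¬ (form apex ≈ 0#)

    span∈ : ∀ {u x y} → u ∈⟨ x , y ⟩ → form x ≈ 0# → form y ≈ 0# → form u ≈ 0#
    span∈ (a , b , h) x∈ y∈ = trans (form-cong h) (trans (form-lc a _ b _)
      (trans (+-cong (b≈0⇒ab≈0 x∈) (b≈0⇒ab≈0 y∈)) (+-identityˡ 0#)))

    ∥∈ : ∀ {u x} → u ∥ x → form x ≈ 0# → form u ≈ 0#
    ∥∈ u∥x x∈ = span∈ (∥⇒∈ u∥x) x∈ x∈

  open Plane using (form)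

  -- Coordinates on the lines through v in the plane π.
  record View (π : Plane) (v : Vector 4) : Set (c ⊔ ℓ) where
    field
      linear : Linear 4 2
    open Linear linear public
    field
      vanishes : Zero (map v)
      kernel : ∀ {x} → form π x ≈ 0# → Zero (map x) → x ∥ v
      parallel : ∀ {x y} → form π x ≈ 0# → form π y ≈ 0# → map x ∥ map y → x ∈⟨ y , v ⟩
      lift : ∀ y → ∃ λ x → form π x ≈ 0# × map x ≐ y

  opaque
    -- The line joining `v` to the apex meets `π` only in `v`, so projecting from it separates
    -- exactly the lines of `π` through `v`. A preimage is moved into `π` by a multiple of the apex.
    view : ∀ π v → ¬ Zero v → form π v ≈ 0# → View π v
    view π v v≢0 v∈ = record
      { linear = φ.linear
      ; vanishes = φ.vanishes ∈-left
      ; kernel = ker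
      ; parallel = λ {x} {y} x∈ y∈ (a , h) →
          let (b , h′) = ker (span∈ (1# , - a , λ _ → refl) x∈ y∈)
                (λ j → trans (φ.map-lc 1# x (- a) y j) (trans (+-congʳ (*-congˡ (h j)))
                  (solve 2 (λ a z → :1 :* (a :* z) :+ :- a :* z := :0) refl a (φ.map y j))))
          in a , b , λ j → trans (solve 3 (λ x a y → x := a :* y :+ (:1 :* x :+ :- a :* y)) refl (x j) a (y j)) (+-congˡ (h′ j))
      ; lift = λ y → let (x , h) = φ.lift y in
          lc 1# x (- (form π x * r)) apex ,
          trans (form-lc 1# x _ apex) (trans (solve 3 (λ f r z → :1 :* f :+ :- (f :* r) :* z := f :* (:1 :+ :- (z :* r))) refl (form π x) r (form π apex))
            (b≈0⇒ab≈0 (trans (+-congˡ (-‿cong eq)) (-‿inverseʳ 1#)))) ,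
          λ j → trans (φ.map-lc 1# x _ apex j) (trans (+-cong (*-identityˡ _) (b≈0⇒ab≈0 (φ.vanishes ∈-right j))) (trans (+-identityʳ _) (h j)))
      }
      where
      open Plane π using (apex; apex∉; span∈; ∥∈; form-lc; form-cong)
      module φ = Pencil (pencil v apex v≢0 (λ z∥v → apex∉ (∥∈ z∥v v∈)))
      r : Carrier
      r = proj₁ (inverse _ apex∉)
      eq : form π apex * r ≈ 1#
      eq = proj₂ (inverse _ apex∉)
      ker : ∀ {x} → form π x ≈ 0# → Zero (φ.map x) → x ∥ v
      ker {x} x∈ φx≈0 with φ.kernel φx≈0
      ... | a , b , h = a , λ j → trans (h j) (trans (+-congˡ (a≈0⇒ab≈0 b≈0)) (+-identityʳ _))
        where
        bz≈0 : b * form π apex ≈ 0#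
        bz≈0 = trans (sym (trans (+-congʳ (b≈0⇒ab≈0 v∈)) (+-identityˡ _))) (trans (sym (form-lc a v b apex)) (trans (sym (form-cong h)) x∈))
        b≈0 : b ≈ 0#
        b≈0 = trans (sym (*-identityʳ b)) (trans (*-congˡ (sym eq)) (trans (sym (*-assoc _ _ _)) (a≈0⇒ab≈0 bz≈0)))

  module _ {x y : Vector 4} (φ : Pencil x y) (p : Vector 2) (p≢0 : ¬ Zero p) where
    private module φ = Pencil φ

    pencil-plane : Plane
    pencil-plane = record
      { form = λ u → det p (φ.map u)
      ; form-cong = λ h → +-cong (*-congˡ (φ.map-cong h zero)) (-‿cong (*-congˡ (φ.map-cong h (suc zero))))
      ; form-lc = λ a u b v → trans (+-cong (*-congˡ (φ.map-lc a u b v zero)) (-‿cong (*-congˡ (φ.map-lc a u b v (suc zero)))))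
          (solve 8 (λ a b p₀ p₁ u₀ u₁ v₀ v₁ → p₁ :* (a :* u₀ :+ b :* v₀) :+ :- (p₀ :* (a :* u₁ :+ b :* v₁))
             := a :* (p₁ :* u₀ :+ :- (p₀ :* u₁)) :+ b :* (p₁ :* v₀ :+ :- (p₀ :* v₁))) refl
             a b (p zero) (p (suc zero)) (φ.map u zero) (φ.map u (suc zero)) (φ.map v zero) (φ.map v (suc zero)))
      ; apex = proj₁ (φ.lift (proj₁ off))
      ; apex∉ = λ h → proj₂ (off) (trans (+-cong (*-congˡ (sym (proj₂ (φ.lift (proj₁ off)) zero)))
          (-‿cong (*-congˡ (sym (proj₂ (φ.lift (proj₁ off)) (suc zero)))))) h)
      }
      where
      off : ∃ λ v → ¬ (det p v ≈ 0#)
      off with p (suc zero) ≈? 0#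
      ... | no p₁≉0 = (1# VF.∷ 0# VF.∷ VF.[]) , λ h → p₁≉0 (trans (solve 2 (λ p₀ p₁ → p₁ := p₁ :* :1 :+ :- (p₀ :* :0)) refl (p zero) (p (suc zero))) h)
      ... | yes p₁≈0 = (0# VF.∷ 1# VF.∷ VF.[]) , λ h → p≢0 λ
        { zero → trans (solve 2 (λ p₀ p₁ → p₀ := :- (p₁ :* :0 :+ :- (p₀ :* :1))) refl (p zero) (p (suc zero))) (trans (-‿cong h) (solve 0 (:- :0 := :0) refl))
        ; (suc zero) → p₁≈0 }

    pencil-plane-base : ∀ {u} → u ∈⟨ x , y ⟩ → form pencil-plane u ≈ 0#
    pencil-plane-base u∈ = ∥⇒det≈0 {p} (Zero-∥ (φ.vanishes u∈))

  -- The case `i ≡ j` is allowed in `no-three`, which thus also says that different indices give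
  -- different points.
  record CapSet (k : ℕ) : Set (c ⊔ ℓ) where
    field
      P : Fin k → Vector 4
      P≢0 : ∀ i → ¬ Zero (P i)
      no-three : ∀ {i j l} → i ≢ l → j ≢ l → ¬ P l ∈⟨ P i , P j ⟩

    nonparallel : ∀ {i l} → i ≢ l → ¬ P l ∥ P i
    nonparallel i≢l = no-three i≢l i≢l ∘ ∥⇒∈

    -- The negation expresses tangency at `P l`; it also holds when `x` represents `P l` itself.
    Secant : Vector 4 → Fin k → Set (c ⊔ ℓ)
    Secant x l = ∃ λ m → m ≢ l × P m ∈⟨ x , P l ⟩

    secant? : ∀ x l → Dec (Secant x l)
    secant? x l = Fin.any? (λ m → ¬? (m Fin.≟ l) ×-dec (P m ∈?⟨ x , P l ⟩))

    On : Plane → Fin k → Set ℓ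
    On π l = form π (P l) ≈ 0#

    InPlane : ℕ → Plane → Set ℓ
    InPlane r π = Distinct r (On π)

  open Distinct

  module _ {k : ℕ} (K : CapSet k) where
    open CapSet K

    spread-view : ∀ {s} π {l} (l∈ : On π l) (d : Distinct s (λ i → On π i × i ≢ l)) →
      ℓᵖ.Spread s (View.map (view π (P l) (P≢0 l) l∈) ∘ P ∘ to d)
    spread-view π {l} l∈ d =
      (λ i h → nonparallel (proj₂ (holds d i) ∘ ≡.sym) (V.kernel (proj₁ (holds d i)) h)) ,
      λ i j i≢j h → no-three (i≢j ∘ ≡.sym ∘ to-injective d) (proj₂ (holds d i) ∘ ≡.sym)
        (V.parallel (proj₁ (holds d i)) (proj₁ (holds d j)) h)
      where module V = View (view π (P l) (P≢0 l) l∈)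

    -- Each of the q + 1 lines of the plane through a cap point carries at most one further cap
    -- point.
    plane-size : ∀ {r} π → InPlane r π → r ≤ suc (suc q)
    plane-size {zero} π d = z≤n
    plane-size {suc r} π d = s≤s (ℓᵖ.spread-bound (spread-view π (holds d zero) (remove d zero)))

    Full : Plane → Set (c ⊔ ℓ)
    Full π = ∀ {l} → On π l → ∀ {x} → form π x ≈ 0# → ¬ x ∥ P l → Secant x l

    -- Equality in the count of `plane-size`: no line of the plane through a cap point can lack a
    -- second one.
    full : ∀ π → InPlane (suc (suc q)) π → Full π
    full π d {l} l∈ {x} x∈ x∦P =
      let (j , h) = ℓᵖ.spread-onto (spread-view π l∈ d′) {V.map x} (x∦P ∘ V.kernel x∈) in
      to d′ j , proj₂ (holds d′ j) , V.parallel (proj₁ (holds d′ j)) x∈ h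
      where
      module V = View (view π (P l) (P≢0 l) l∈)
      d′ : Distinct (suc q) (λ i → On π i × i ≢ l)
      d′ = avoid d l

    -- The q + 1 planes through the line cannot all contain at most q - 1 of the points, since (q +
    -- 1)(q - 1) < q^2.
    crowded-plane : ∀ {a s x y} {Q : Fin k → Set a} (φ : Pencil x y) (d : Distinct s Q) →
      (∀ i → Q i → ¬ Zero (Pencil.map φ (P i))) → q ℕ.* q ≤ s → 1 ≤ q →
      ∃ λ π → (∀ {u} → u ∈⟨ x , y ⟩ → form π u ≈ 0#) × Distinct q (λ i → Q i × On π i)
    crowded-plane {s = s} {Q = Q} φ d φP≢0 q²≤s 1≤q =
      let (y , e) = crowded-fibre {r = ℕ.pred q} (bound q q²≤s 1≤q) class in
      π y , pencil-plane-base φ (ℓᵖ.point y) (ℓᵖ.point≢0 y) ,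
      ≡.subst (λ r → Distinct r (λ i → Q i × On (π y) i)) (ℕ.suc-pred q {{ℕ.>-nonZero 1≤q}}) (compose y e)
      where
      vec : Fin s → Vector 2
      vec j = Pencil.map φ (P (to d j))
      class : Fin s → Fin (suc q)
      class j = proj₁ (ℓᵖ.locate (vec j) (φP≢0 _ (holds d j)))
      in-class : ∀ j → vec j ∥ ℓᵖ.point (class j)
      in-class j = proj₂ (ℓᵖ.locate (vec j) (φP≢0 _ (holds d j)))
      π : Fin (suc q) → Plane
      π y = pencil-plane φ (ℓᵖ.point y) (ℓᵖ.point≢0 y)
      compose : ∀ {r} y → Distinct r (λ j → class j ≡ y) → Distinct r (λ i → Q i × On (π y) i)
      compose y e = record
        { to = to d ∘ to e
        ; to-injective = to-injective e ∘ to-injective d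
        ; holds = λ j → holds d (to e j) ,
            ∥⇒det≈0 {ℓᵖ.point y} {vec (to e j)} (≡.subst (λ y → vec (to e j) ∥ ℓᵖ.point y) (holds e j) (in-class (to e j)))
        }
      bound : ∀ q → q ℕ.* q ≤ s → 1 ≤ q → suc q ℕ.* ℕ.pred q < s
      bound (suc r) q²≤s _ = ℕ.≤-trans (ℕ.≤-reflexive (eq r)) q²≤s
        where
        open import Data.Nat.Solver using (module +-*-Solver)
        module S = +-*-Solver
        eq : ∀ r → suc (suc (suc r) ℕ.* r) ≡ suc r ℕ.* suc r
        eq = S.solve 1 (λ r → S.con 1 S.:+ (S.con 2 S.:+ r) S.:* r S.:= (S.con 1 S.:+ r) S.:* (S.con 1 S.:+ r)) ≡.refl

    -- The second points of the secants through v pair off the points of the cap concerned.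
    pairing : ∀ {a r} {Q : Fin k → Set a} (d : Distinct r Q) → Exhaustive d → ∀ {v} → (∀ l → ¬ v ∥ P l) →
      (∀ l → Q l → ∃ λ m → Q m × m ≢ l × P m ∈⟨ v , P l ⟩) → ∃ λ h → r ≡ h ℕ.+ h
    pairing {r = r} d exh {v} v∦P other = fixpoint-free-involution-even σ σ≢ σσ
      where
      partner : ∀ j → ∃ λ i → to d i ≢ to d j × P (to d i) ∈⟨ v , P (to d j) ⟩
      partner j with other (to d j) (holds d j)
      ... | m , Qm , m≢ , m∈ with exh m Qm
      ...   | i , ≡.refl = i , m≢ , m∈
      σ : Fin r → Fin r
      σ = proj₁ ∘ partner
      σ≢ : ∀ j → σ j ≢ j
      σ≢ j eq = proj₁ (proj₂ (partner j)) (≡.cong (to d) eq)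
      σσ : ∀ j → σ (σ j) ≡ j
      σσ j = decidable-stable (σ (σ j) Fin.≟ j) λ neq →
        let (m≢l , m∈) = proj₂ (partner j) ; (m′≢m , m′∈) = proj₂ (partner (σ j)) in
        no-three (m′≢m ∘ ≡.sym) (neq ∘ ≡.sym ∘ to-injective d)
          (∈-trans m′∈ (exchange m∈ (nonparallel (m≢l ∘ ≡.sym))) ∈-left)

    -- Supplies a point of a secant outside the cap, from which the points of a plane section can be
    -- paired.
    sum-off-cap : ∀ {i j} → i ≢ j → ∀ l → ¬ lc 1# (P i) 1# (P j) ∥ P l
    sum-off-cap {i} {j} i≢j l (a , h) with l Fin.≟ i
    ... | yes ≡.refl = nonparallel i≢j (a + - 1# , λ m → trans
      (solve 2 (λ x y → y := (:1 :* x :+ :1 :* y) :+ :- x) refl (P i m) (P j m))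
      (trans (+-congʳ (h m)) (solve 2 (λ a x → a :* x :+ :- x := (a :+ :- :1) :* x) refl a (P i m))))
    ... | no l≢i = no-three l≢i (i≢j ∘ ≡.sym) (a , - 1# , λ m → trans
      (solve 2 (λ x y → x := (:1 :* x :+ :1 :* y) :+ :- :1 :* y) refl (P i m) (P j m)) (+-congʳ (h m)))

-- Lines through a cap point, parity of q, and ovals.

module CapBound {c ℓ} (F : Field c ℓ) {q : ℕ} (card : LinearAlgebra.HasCardinality F q) where
  open Field F hiding (zero)
  open LinearAlgebra F
  open FiniteSums F
  open FiniteField F card
  open CapGeometry F card
  open ℤ-Coefficients commutativeRing
  open Distinct
  open Plane using (form)

  module _ {k : ℕ} (K : CapSet k) where
    open CapSet K
    private module Q l = Quotient (quotient (P l) (P≢0 l))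

    spread-quotient : ∀ {s} l (d : Distinct s (λ i → ⊤ × i ≢ l)) → πᵖ.Spread s (Q.map l ∘ P ∘ to d)
    spread-quotient l d =
      (λ i h → nonparallel (proj₂ (holds d i) ∘ ≡.sym) (Q.kernel l h)) ,
      λ i j i≢j (a , h) → no-three (i≢j ∘ ≡.sym ∘ to-injective d) (proj₂ (holds d i) ∘ ≡.sym)
        (let (b , h′) = Q.kernel l {lc 1# (P (to d i)) (- a) (P (to d j))}
               (λ m → trans (Q.map-lc l 1# (P (to d i)) (- a) (P (to d j)) m) (trans (+-congʳ (*-congˡ (h m)))
                 (solve 2 (λ a z → :1 :* (a :* z) :+ :- a :* z := :0) refl a (Q.map l (P (to d j)) m))))
         in a , b , λ m → trans (solve 3 (λ x a y → x := a :* y :+ (:1 :* x :+ :- a :* y)) refl (P (to d i) m) a (P (to d j) m)) (+-congˡ (h′ m)))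

  -- Each of the q^2 + q + 1 lines through a cap point carries at most one of the other `k` points.
  -- For q = 2 this is already the bound 8.
  cap-size : ∀ {k} → CapSet (suc k) → k ≤ q ℕ.* q ℕ.+ suc q
  cap-size K = πᵖ.spread-bound (spread-quotient K zero (avoid everything zero))

  complete⇒secant : ∀ {k} → k ≡ q ℕ.* q ℕ.+ suc q → (K : CapSet (suc k)) → let open CapSet K in
    ∀ l x → ¬ x ∥ P l → Secant x l
  complete⇒secant {k} k≡ K l x x∦P =
    let (j , a , h) = πᵖ.spread-onto (spread-quotient K l d) {Q.map x} (x∦P ∘ Q.kernel)
        (b , h′) = Q.kernel {lc 1# (P (to d j)) (- a) x}
               (λ m → trans (Q.map-lc 1# (P (to d j)) (- a) x m) (trans (+-congʳ (*-congˡ (h m)))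
                 (solve 2 (λ a z → :1 :* (a :* z) :+ :- a :* z := :0) refl a (Q.map x m))))
    in to d j , proj₂ (holds d j) , a , b ,
       λ m → trans (solve 3 (λ u a y → u := a :* y :+ (:1 :* u :+ :- a :* y)) refl (P (to d j) m) a (x m)) (+-congˡ (h′ m))
    where
    open CapSet K
    module Q = Quotient (quotient (P l) (P≢0 l))
    d : Distinct (q ℕ.* q ℕ.+ suc q) (λ i → ⊤ × i ≢ l)
    d = ≡.subst (λ r → Distinct r (λ i → ⊤ × i ≢ l)) k≡ (avoid everything l)

  incomplete⇒tangent : ∀ {k} → k < q ℕ.* q ℕ.+ suc q → (K : CapSet (suc k)) → let open CapSet K in
    ∃ λ x → ¬ x ∥ P zero × ¬ Secant x zero
  incomplete⇒tangent {k} k< K =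
    let (i , missed) = πᵖ.missed-point (λ j → Q.map (P (suc j))) k<
        (x , h) = Q.lift (πᵖ.point i)
        x≢0 : ¬ Zero (Q.map x)
        x≢0 qx≈0 = πᵖ.point≢0 i λ m → trans (sym (h m)) (qx≈0 m)
        tangent : ¬ Secant x zero
        tangent = λ
          { (zero , m≢0 , _) → m≢0 ≡.refl
          ; (suc j , m≢0 , m∈) → missed j (∥-trans (1# , λ m → sym (trans (*-identityˡ _) (h m)))
              (∥-sym (λ qP≈0 → nonparallel (λ ()) (Q.kernel qP≈0)) (∈-Zero (Q.map-∈ m∈) Q.vanishes))) }
    in x , (λ x∥P → x≢0 (∥-Zero (Q.map-∥ x∥P) Q.vanishes)) , tangent
    where
    open CapSet K
    module Q = Quotient (quotient (P zero) (P≢0 zero))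

  module _ (1≤q : 1 ≤ q) {k : ℕ} (q²≤k : q ℕ.* q ≤ k) (K : CapSet (suc (suc k))) where
    open CapSet K

    -- At least q^2 cap points lie off the secant, so some plane through it contains q of them, and
    -- with the two given points it attains the maximum.
    secant-plane : ∀ {i j} → i ≢ j → ∃ λ π → On π i × On π j × InPlane (suc (suc q)) π
    secant-plane {i} {j} i≢j =
      let (π , base , e) = crowded-plane K φ d outside q²≤k 1≤q in
      π , base ∈-left , base ∈-right ,
      extend (extend (map-holds (λ _ → proj₂) e) j (base ∈-right) (λ l → proj₂ (proj₁ (holds e l)))) i (base ∈-left)
        (λ { zero eq → i≢j (≡.sym eq) ; (suc l) → proj₂ (proj₁ (proj₁ (holds e l))) })
      where
      φ : Pencil (P i) (P j)
      φ = pencil (P i) (P j) (P≢0 i) (nonparallel i≢j)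
      d : Distinct k (λ l → (⊤ × l ≢ i) × l ≢ j)
      d = avoid (avoid everything i) j
      outside : ∀ l → (⊤ × l ≢ i) × l ≢ j → ¬ Zero (Pencil.map φ (P l))
      outside l ((_ , l≢i) , l≢j) h = no-three (l≢i ∘ ≡.sym) (l≢j ∘ ≡.sym) (Pencil.kernel φ h)

    -- Seen from a point of a secant off the cap, every line to a point of a section of size q + 2
    -- is a secant, so these points fall into pairs.
    even-order : ∃ λ h → suc (suc q) ≡ h ℕ.+ h
    even-order = pairing K d (exhaustive (ℕ.1+n≰n ∘ plane-size K π) d) {x} x-off λ l l∈ →
      let (m , m≢l , m∈) = full K π d l∈ x∈ (x-off l) in m , Plane.span∈ π m∈ x∈ l∈ , m≢l , m∈
      where
      plane = secant-plane {zero} {suc zero} (λ ())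
      π = proj₁ plane
      d = proj₂ (proj₂ (proj₂ plane))
      x : Vector 4
      x = lc 1# (P zero) 1# (P (suc zero))
      x-off : ∀ l → ¬ x ∥ P l
      x-off = sum-off-cap K {zero} {suc zero} (λ ())
      x∈ : form π x ≈ 0#
      x∈ = Plane.span∈ π (1# , 1# , λ _ → refl) (proj₁ (proj₂ plane)) (proj₁ (proj₂ (proj₂ plane)))

    -- A plane with a tangent meets the cap in at most q + 1 points; when it has
    -- q + 1 of them, they form an oval, whose tangents are concurrent as q is even.
    module Oval (π : Plane) (d : InPlane (suc q) π) {o : Fin (suc (suc k))} (o∈ : On π o)
                {t : Vector 4} (t∈ : form π t ≈ 0#) (t∦o : ¬ t ∥ P o) (tangent : ¬ Secant t o) where
      open Plane π using (span∈; ∥∈)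

      exh : Exhaustive d
      exh = exhaustive (λ d′ → tangent (full K π d′ o∈ t∈ t∦o)) d

      -- A cap point serves for itself. From any other point, secants alone would pair off the q + 1
      -- points of the oval, an odd number.
      tangency : ∀ {x} → form π x ≈ 0# → ¬ Zero x → ∃ λ l → On π l × ¬ Secant x l
      tangency {x} x∈ x≢0 with Fin.any? (λ l → x ∥? P l)
      ... | yes (l , x∥P) = l , ∥∈ (∥-sym x≢0 x∥P) x∈ , λ (m , m≢l , m∈) →
              nonparallel (m≢l ∘ ≡.sym) (∈-diagonal (∈-trans m∈ (∥⇒∈ x∥P) ∈-left))
      ... | no off with Fin.all? (λ j → secant? x (to d j))
      ...   | no ¬all = let (j , ¬sec) = Fin.¬∀⟶∃¬ _ _ (λ j → secant? x (to d j)) ¬all in to d j , holds d j , ¬sec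
      ...   | yes all = contradiction even-order (consecutive-not-both-even
              (pairing K d exh (λ l h → off (l , h)) λ l l∈ → other l (exh l l∈)))
        where
        other : ∀ l → (∃ λ j → to d j ≡ l) → ∃ λ m → On π m × m ≢ l × P m ∈⟨ x , P l ⟩
        other l (j , ≡.refl) = let (m , m≢l , m∈) = all j in m , span∈ m∈ x∈ (holds d j) , m≢l , m∈

      tangents-at-end : ∀ {a b x} → a ≢ b → x ∈⟨ P a , P b ⟩ → ¬ Secant x a → x ∥ P a
      tangents-at-end {a} {b} {x} a≢b x∈ ¬sec = decidable-stable (x ∥? P a) λ x∦ →
        ¬sec (b , a≢b ∘ ≡.sym , exchange (∈-comm x∈) x∦)

      -- If `l` is neither `a` nor `b`, different `x` and `y` give different tangents at `P l`,
      -- which with the q lines to the other oval points are too many. If `l` is an end of the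
      -- secant, both points are `P l`.
      one-tangent : ∀ {a b l x y} → a ≢ b → On π a → On π b → On π l → ¬ Zero x → ¬ Zero y →
        x ∈⟨ P a , P b ⟩ → y ∈⟨ P a , P b ⟩ → ¬ Secant x l → ¬ Secant y l → x ∥ y
      one-tangent {a} {b} {l} {x} {y} a≢b a∈ b∈ l∈ x≢0 y≢0 x∈ab y∈ab ¬x ¬y with a Fin.≟ l | b Fin.≟ l
      ... | yes ≡.refl | _ = ∥-trans (tangents-at-end a≢b x∈ab ¬x) (∥-sym y≢0 (tangents-at-end a≢b y∈ab ¬y))
      ... | no _ | yes ≡.refl = ∥-trans (tangents-at-end (a≢b ∘ ≡.sym) (∈-comm x∈ab) ¬x)
              (∥-sym y≢0 (tangents-at-end (a≢b ∘ ≡.sym) (∈-comm y∈ab) ¬y))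
      ... | no a≢l | no b≢l = decidable-stable (x ∥? y) λ x∦y → ℕ.1+n≰n (ℓᵖ.spread-bound (spread x∦y))
        where
        module V = View (view π (P l) (P≢0 l) l∈)
        x∈ = span∈ x∈ab a∈ b∈
        y∈ = span∈ y∈ab a∈ b∈
        others : Distinct q (λ i → On π i × i ≢ l)
        others = avoid d l
        off-line : ∀ {z} → ¬ Zero z → z ∈⟨ P a , P b ⟩ → form π z ≈ 0# → ¬ Zero (V.map z)
        off-line z≢0 z∈ab z∈ h = no-three a≢l b≢l (∈-trans (∥⇒∈ {y = P a} (∥-sym z≢0 (V.kernel z∈ h))) z∈ab ∈-left)
        not-tangent : ∀ {z} → form π z ≈ 0# → ¬ Secant z l → ∀ i → ¬ V.map (P (to others i)) ∥ V.map z
        not-tangent z∈ ¬z i h = ¬z (to others i , proj₂ (holds others i) , V.parallel (proj₁ (holds others i)) z∈ h)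
        spread : ¬ x ∥ y → ℓᵖ.Spread (suc (suc q)) (V.map y VF.∷ V.map x VF.∷ V.map ∘ P ∘ to others)
        spread x∦y = ℓᵖ.spread-∷ (off-line y≢0 y∈ab y∈)
          (λ { zero h → no-three a≢l b≢l (∈-trans (exchange (∈-comm (V.parallel x∈ y∈ h)) x∦y) x∈ab y∈ab)
             ; (suc i) → not-tangent y∈ ¬y i })
          (ℓᵖ.spread-∷ (off-line x≢0 x∈ab x∈) (not-tangent x∈ ¬x) (spread-view K π l∈ others))

      -- The q + 1 points of a secant are distributed bijectively over the tangents of the oval.
      no-secant-through : ∀ {v l l′} → l ≢ l′ → On π l → On π l′ → ¬ Secant v l → ¬ Secant v l′ → ¬ Zero v →
        ∀ {a b} → a ≢ b → On π a → On π b → ¬ v ∈⟨ P a , P b ⟩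
      no-secant-through {v} {l} {l′} l≢l′ l∈ l′∈ ¬l ¬l′ v≢0 {a} {b} a≢b a∈ b∈ v∈ab@(α , β , h) = clash
        where
        point : Fin (suc q) → Vector 4
        point y = lc (ℓᵖ.point y zero) (P a) (ℓᵖ.point y (suc zero)) (P b)
        point∈ : ∀ y → point y ∈⟨ P a , P b ⟩
        point∈ y = _ , _ , λ _ → refl
        point≢0 : ∀ y → ¬ Zero (point y)
        point≢0 y h = ℓᵖ.point≢0 y λ { zero → proj₁ coords ; (suc zero) → proj₂ coords }
          where coords = independent (P≢0 a) (nonparallel a≢b) h
        point-distinct : ∀ {y y′} → point y ∥ point y′ → y ≡ y′
        point-distinct {y} {y′} (r , h) = ℓᵖ.point-distinct (r , λ
          { zero → a-b≈0⇒a≈b (proj₁ coords) ; (suc zero) → a-b≈0⇒a≈b (proj₂ coords) })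
          where
          coords = independent {a = ℓᵖ.point y zero + - (r * ℓᵖ.point y′ zero)} {b = ℓᵖ.point y (suc zero) + - (r * ℓᵖ.point y′ (suc zero))}
            (P≢0 a) (nonparallel a≢b) λ m →
            trans (solve 7 (λ p s p′ s′ r x y → (p :+ :- (r :* p′)) :* x :+ (s :+ :- (r :* s′)) :* y
                     := (p :* x :+ s :* y) :+ :- (r :* (p′ :* x :+ s′ :* y))) refl
                     (ℓᵖ.point y zero) (ℓᵖ.point y (suc zero)) (ℓᵖ.point y′ zero) (ℓᵖ.point y′ (suc zero)) r (P a m) (P b m))
              (a≈b⇒a-b≈0 (h m))
        tangent-at : ∀ y → ∃ λ l → On π l × ¬ Secant (point y) l
        tangent-at y = tangency (span∈ (point∈ y) a∈ b∈) (point≢0 y)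
        g : Fin (suc q) → Fin (suc q)
        g y = proj₁ (exh (proj₁ (tangent-at y)) (proj₁ (proj₂ (tangent-at y))))
        g-tangent : ∀ y → ¬ Secant (point y) (to d (g y))
        g-tangent y = ≡.subst (λ l → ¬ Secant (point y) l)
          (≡.sym (proj₂ (exh (proj₁ (tangent-at y)) (proj₁ (proj₂ (tangent-at y)))))) (proj₂ (proj₂ (tangent-at y)))
        g-injective : Injective _≡_ _≡_ g
        g-injective {y} {y′} eq = point-distinct (one-tangent a≢b a∈ b∈ (holds d (g y)) (point≢0 y) (point≢0 y′)
          (point∈ y) (point∈ y′) (g-tangent y) (≡.subst (λ j → ¬ Secant (point y′) (to d j)) (≡.sym eq) (g-tangent y′)))
        coordinates : Vector 2
        coordinates = α VF.∷ β VF.∷ VF.[]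
        located : ∃ λ y → coordinates ∥ ℓᵖ.point y
        located = ℓᵖ.locate coordinates λ z → v≢0 λ m → trans (h m)
          (trans (+-cong (a≈0⇒ab≈0 (z zero)) (a≈0⇒ab≈0 (z (suc zero)))) (+-identityˡ 0#))
        y₀ : Fin (suc q)
        y₀ = proj₁ located
        v∥y₀ : v ∥ point y₀
        v∥y₀ = let (r , h′) = proj₂ located in r , λ m → trans (h m)
          (trans (+-cong (*-congʳ (h′ zero)) (*-congʳ (h′ (suc zero))))
            (solve 5 (λ r p s x y → r :* p :* x :+ r :* s :* y := r :* (p :* x :+ s :* y)) refl r
              (ℓᵖ.point y₀ zero) (ℓᵖ.point y₀ (suc zero)) (P a m) (P b m)))
        -- By surjectivity `m` is the tangency of some point of the secant, and `one-tangent`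
        -- identifies that point with `v`.
        only-at : ∀ {m} → On π m → ¬ Secant v m → to d (g y₀) ≡ m
        only-at {m} m∈ ¬m =
          let (j , dj≡m) = exh m m∈
              (y , gy≡j) = injective⇒surjective g g-injective j
              dgy≡m = ≡.trans (≡.cong (to d) gy≡j) dj≡m
              y₀≡y = point-distinct (∥-trans (∥-sym v≢0 v∥y₀) (one-tangent a≢b a∈ b∈ m∈ v≢0 (point≢0 y) v∈ab (point∈ y) ¬m
                (≡.subst (λ m → ¬ Secant (point y) m) dgy≡m (g-tangent y))))
          in ≡.trans (≡.cong (to d ∘ g) y₀≡y) dgy≡m
        clash : ⊥
        clash = l≢l′ (≡.trans (≡.sym (only-at l∈ ¬l)) (only-at l′∈ ¬l′))

-- Enlarging a cap by a nucleus, and caps without tangents.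

sumℕ-∣ : ∀ {n d} (f : Fin n → ℕ) → (∀ i → d ∣ f i) → d ∣ sumℕ f
sumℕ-∣ {zero} f h = _ ∣0
sumℕ-∣ {suc n} f h = ∣m∣n⇒∣m+n (h zero) (sumℕ-∣ (f ∘ suc) (h ∘ suc))

module CapBounds {c ℓ} (F : Field c ℓ) {q : ℕ} (card : LinearAlgebra.HasCardinality F q) where
  open Field F hiding (zero)
  open LinearAlgebra F
  open FiniteSums F
  open FiniteField F card
  open CapGeometry F card
  open CapBound F card
  open ℤ-Coefficients commutativeRing
  open Distinct
  open Plane using (form)

  -- Modulo `v` the plane `π` is spanned by `e₁` and `e₂`; a nontrivial combination of them is
  -- annihilated by the form of `π′`.
  common-direction : ∀ π π′ {v} → ¬ Zero v → form π v ≈ 0# → ∃ λ x → form π x ≈ 0# × form π′ x ≈ 0# × ¬ x ∥ v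
  common-direction π π′ {v} v≢0 v∈ = choose (form π′ e₁ ≈? 0#)
    where
    module V = View (view π v v≢0 v∈)
    module π = Plane π
    module π′ = Plane π′
    e₁ = proj₁ (V.lift (1# VF.∷ 0# VF.∷ VF.[]))
    e₂ = proj₁ (V.lift (0# VF.∷ 1# VF.∷ VF.[]))
    e₁∈ = proj₁ (proj₂ (V.lift (1# VF.∷ 0# VF.∷ VF.[])))
    e₂∈ = proj₁ (proj₂ (V.lift (0# VF.∷ 1# VF.∷ VF.[])))
    Ve₁ = proj₂ (proj₂ (V.lift (1# VF.∷ 0# VF.∷ VF.[])))
    Ve₂ = proj₂ (proj₂ (V.lift (0# VF.∷ 1# VF.∷ VF.[])))
    a = form π′ e₁
    b = form π′ e₂
    choose : Dec (a ≈ 0#) → ∃ λ x → form π x ≈ 0# × form π′ x ≈ 0# × ¬ x ∥ v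
    choose (yes a≈0) = e₁ , e₁∈ , a≈0 , λ e₁∥v →
      0≉1 (trans (sym (∥-Zero (V.map-∥ e₁∥v) V.vanishes zero)) (Ve₁ zero))
    choose (no a≉0) = x , π.span∈ (b , - a , λ _ → refl) e₁∈ e₂∈ ,
      trans (π′.form-lc b e₁ (- a) e₂) (solve 2 (λ a b → b :* a :+ :- a :* b := :0) refl a b) ,
      λ x∥v → a≉0 (trans (solve 2 (λ a b → a := :- (b :* :0 :+ :- a :* :1)) refl a b)
        (trans (-‿cong (trans (+-cong (*-congˡ (sym (Ve₁ (suc zero)))) (*-congˡ (sym (Ve₂ (suc zero)))))
          (trans (sym (V.map-lc b e₁ (- a) e₂ (suc zero))) (∥-Zero (V.map-∥ x∥v) V.vanishes (suc zero)))))
          (solve 0 (:- :0 := :0) refl)))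
      where
      x : Vector 4
      x = lc b e₁ (- a) e₂

  module _ {k : ℕ} (K : CapSet k) where
    open CapSet K

    adjoin : ∀ v → ¬ Zero v → (∀ l → ¬ v ∥ P l) → (∀ {a b} → a ≢ b → ¬ v ∈⟨ P a , P b ⟩) → CapSet (suc k)
    adjoin v v≢0 v-off no-secant = record
      { P = v VF.∷ P
      ; P≢0 = λ { zero → v≢0 ; (suc i) → P≢0 i }
      ; no-three = λ {i} {j} {l} → independent′ i j l
      }
      where
      no-secant′ : ∀ i j → ¬ v ∈⟨ P i , P j ⟩
      no-secant′ i j v∈ with i Fin.≟ j
      ... | yes ≡.refl = v-off i (∈-diagonal v∈)
      ... | no i≢j = no-secant i≢j v∈
      independent′ : ∀ i j l → i ≢ l → j ≢ l → ¬ (v VF.∷ P) l ∈⟨ (v VF.∷ P) i , (v VF.∷ P) j ⟩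
      independent′ zero j zero i≢l j≢l h = i≢l ≡.refl
      independent′ (suc i) zero zero i≢l j≢l h = j≢l ≡.refl
      independent′ (suc i) (suc j) zero i≢l j≢l h = no-secant′ i j h
      independent′ zero zero (suc l) i≢l j≢l h = v-off l (∥-sym (P≢0 l) (∈-diagonal h))
      independent′ zero (suc j) (suc l) i≢l j≢l h =
        no-secant′ l j (exchange h (nonparallel (j≢l ∘ ≡.cong suc)))
      independent′ (suc i) zero (suc l) i≢l j≢l h =
        no-secant′ l i (exchange (∈-comm h) (nonparallel (i≢l ∘ ≡.cong suc)))
      independent′ (suc i) (suc j) (suc l) i≢l j≢l h = no-three (i≢l ∘ ≡.cong suc) (j≢l ∘ ≡.cong suc) h

  module Enlarge (1≤q : 1 ≤ q) {k : ℕ} (q²≤k : q ℕ.* q ≤ k) (k< : suc k < q ℕ.* q ℕ.+ suc q)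
                 (K : CapSet (suc (suc k))) where
    open CapSet K

    o : Fin (suc (suc k))
    o = zero
    t : Vector 4
    t = proj₁ (incomplete⇒tangent k< K)
    t∦o : ¬ t ∥ P o
    t∦o = proj₁ (proj₂ (incomplete⇒tangent k< K))
    t-tangent : ¬ Secant t o
    t-tangent = proj₂ (proj₂ (incomplete⇒tangent k< K))

    -- The pencil of planes through the tangent at `o`: all other cap points lie off this line, and
    -- they number at least q^2.
    oval-plane : ∃ λ π → (∀ {u} → u ∈⟨ P o , t ⟩ → form π u ≈ 0#) × Distinct q (λ i → (⊤ × i ≢ o) × On π i)
    oval-plane = crowded-plane K (pencil (P o) t (P≢0 o) t∦o) (avoid everything o)
      (λ l (_ , l≢o) h → t-tangent (l , l≢o , ∈-comm (Pencil.kernel (pencil (P o) t (P≢0 o) t∦o) h)))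
      (ℕ.m≤n⇒m≤1+n q²≤k) 1≤q

    π : Plane
    π = proj₁ oval-plane
    open Plane π using (span∈)
    others : Distinct q (λ i → (⊤ × i ≢ o) × On π i)
    others = proj₂ (proj₂ oval-plane)
    o∈ : On π o
    o∈ = proj₁ (proj₂ oval-plane) ∈-left
    t∈ : form π t ≈ 0#
    t∈ = proj₁ (proj₂ oval-plane) ∈-right
    d : InPlane (suc q) π
    d = extend (map-holds (λ _ → proj₂) others) o o∈ (λ j → proj₂ (proj₁ (holds others j)))

    open Oval 1≤q q²≤k K π d o∈ t∈ t∦o t-tangent

    b : Fin (suc (suc k))
    b = to others (Fin.fromℕ< 1≤q)
    b≢o : b ≢ o
    b≢o = proj₂ (proj₁ (holds others (Fin.fromℕ< 1≤q)))

    -- Taken on the secant `o b` and off the cap, so that the tangent through it touches the oval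
    -- elsewhere than at `o`.
    x : Vector 4
    x = lc 1# (P o) 1# (P b)
    x∈ : form π x ≈ 0#
    x∈ = span∈ (1# , 1# , λ _ → refl) o∈ (proj₂ (holds others (Fin.fromℕ< 1≤q)))
    x-off : ∀ l → ¬ x ∥ P l
    x-off = sum-off-cap K (b≢o ∘ ≡.sym)
    x≢0 : ¬ Zero x
    x≢0 x≈0 = x-off o (Zero-∥ x≈0)

    l : Fin (suc (suc k))
    l = proj₁ (tangency x∈ x≢0)
    l∈ : On π l
    l∈ = proj₁ (proj₂ (tangency x∈ x≢0))
    x-tangent : ¬ Secant x l
    x-tangent = proj₂ (proj₂ (tangency x∈ x≢0))
    l≢o : l ≢ o
    l≢o l≡o = ≡.subst (λ l → ¬ Secant x l) l≡o x-tangent (b , b≢o , 1# , - 1# , λ m →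
      solve 2 (λ x y → y := :1 :* (:1 :* x :+ :1 :* y) :+ :- :1 :* x) refl (P o m) (P b m))

    private
      module V = View (view π (P o) (P≢0 o) o∈)
      α β : Carrier
      α = det (V.map t) (V.map (P l))
      β = det (V.map t) (V.map x)
      Vt≢0 : ¬ Zero (V.map t)
      Vt≢0 h = t∦o (V.kernel t∈ h)

    -- Intersection of the tangents `o t` and `x l`: the coefficients make the determinant against
    -- `V.map t` vanish identically.
    nucleus : Vector 4
    nucleus = lc α x (- β) (P l)
    nucleus∈ : form π nucleus ≈ 0#
    nucleus∈ = span∈ (α , - β , λ _ → refl) x∈ l∈
    nucleus∈t : nucleus ∈⟨ t , P o ⟩
    nucleus∈t = V.parallel nucleus∈ t∈ (det≈0⇒∥ Vt≢0 (trans
      (+-cong (*-congˡ (V.map-lc α x (- β) (P l) zero)) (-‿cong (*-congˡ (V.map-lc α x (- β) (P l) (suc zero)))))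
      (solve 6 (λ t₀ t₁ x₀ x₁ l₀ l₁ → let a = t₁ :* l₀ :+ :- (t₀ :* l₁) ; b = t₁ :* x₀ :+ :- (t₀ :* x₁) in
         t₁ :* (a :* x₀ :+ :- b :* l₀) :+ :- (t₀ :* (a :* x₁ :+ :- b :* l₁)) := :0) refl
         (V.map t zero) (V.map t (suc zero)) (V.map x zero) (V.map x (suc zero)) (V.map (P l) zero) (V.map (P l) (suc zero)))))
    -- Otherwise `α` would vanish and `P l` would lie on the tangent at `o`.
    nucleus≢0 : ¬ Zero nucleus
    nucleus≢0 h = t-tangent (l , l≢o , V.parallel l∈ t∈ (det≈0⇒∥ Vt≢0
      (proj₁ (independent {x = x} {y = P l} x≢0 (λ l∥x → x-off l (∥-sym (P≢0 l) l∥x)) h))))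

    tangent-o : ¬ Secant nucleus o
    tangent-o (m , m≢o , m∈) = t-tangent (m , m≢o , ∈-trans m∈ nucleus∈t ∈-right)
    tangent-l : ¬ Secant nucleus l
    tangent-l (m , m≢l , m∈) = x-tangent (m , m≢l , ∈-trans m∈ (α , - β , λ _ → refl) ∈-right)

    nucleus-off : ∀ m → ¬ nucleus ∥ P m
    nucleus-off m n∥m = excluded (m Fin.≟ o)
      where
      excluded : ¬ Dec (m ≡ o)
      excluded (no m≢o) = tangent-o (m , m≢o , ∥⇒∈ (∥-sym nucleus≢0 n∥m))
      excluded (yes m≡o) = tangent-l (m , (λ m≡l → l≢o (≡.trans (≡.sym m≡l) m≡o)) , ∥⇒∈ (∥-sym nucleus≢0 n∥m))

    no-secant-in-π : ∀ {a b} → a ≢ b → On π a → On π b → ¬ nucleus ∈⟨ P a , P b ⟩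
    no-secant-in-π = no-secant-through l≢o l∈ o∈ tangent-l tangent-o nucleus≢0

    private module W = View (view π nucleus nucleus≢0 nucleus∈)

    -- Two oval points in line with the nucleus would put it on a secant, so the q + 1 joining lines
    -- are all the lines of `π` through it.
    spread-from-nucleus : ℓᵖ.Spread (suc q) (W.map ∘ P ∘ to d)
    spread-from-nucleus =
      (λ j h → nucleus-off (to d j) (∥-sym (P≢0 _) (W.kernel (holds d j) h))) ,
      λ i j i≢j h → no-secant-in-π (i≢j ∘ to-injective d) (holds d i) (holds d j)
        (exchange (∈-comm (W.parallel (holds d i) (holds d j) h)) (nonparallel (i≢j ∘ ≡.sym ∘ to-injective d)))

    -- A secant through the nucleus would lie in a plane without tangents, which
    -- meets π in a line through the nucleus, that is, in a tangent.
    no-secant : ∀ {a b} → a ≢ b → ¬ nucleus ∈⟨ P a , P b ⟩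
    no-secant {a} {b} a≢b n∈ab = no-secant-in-π m≢j (span∈ m∈ nucleus∈ (holds d j)) (holds d j)
      (exchange m∈ (nonparallel (m≢j ∘ ≡.sym)))
      where
      plane = secant-plane 1≤q q²≤k K a≢b
      H = proj₁ plane
      nucleus∈H : form H nucleus ≈ 0#
      nucleus∈H = Plane.span∈ H n∈ab (proj₁ (proj₂ plane)) (proj₁ (proj₂ (proj₂ plane)))
      direction = common-direction π H nucleus≢0 nucleus∈
      e = proj₁ direction
      e∈ = proj₁ (proj₂ direction)
      hit = ℓᵖ.spread-onto spread-from-nucleus {W.map e} (proj₂ (proj₂ (proj₂ direction)) ∘ W.kernel e∈)
      j = proj₁ hit
      j∈H : On H (to d j)
      j∈H = Plane.span∈ H (W.parallel (holds d j) e∈ (proj₂ hit)) (proj₁ (proj₂ (proj₂ direction))) nucleus∈H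
      second = full K H (proj₂ (proj₂ (proj₂ plane))) j∈H nucleus∈H (nucleus-off (to d j))
      m≢j = proj₁ (proj₂ second)
      m∈ = proj₂ (proj₂ second)

    enlarged : CapSet (suc (suc (suc k)))
    enlarged = adjoin K nucleus nucleus≢0 nucleus-off no-secant

  module Complete {k : ℕ} (k≡ : suc k ≡ q ℕ.* q ℕ.+ suc q) (K : CapSet (suc (suc k))) where
    open CapSet K

    x : Vector 4
    x = lc 1# (P zero) 1# (P (suc zero))
    x-off : ∀ l → ¬ x ∥ P l
    x-off = sum-off-cap K {zero} {suc zero} (λ ())
    x≢0 : ¬ Zero x
    x≢0 x≈0 = x-off zero (Zero-∥ x≈0)

    private module Q = Quotient (quotient x x≢0)

    QP≢0 : ∀ l → ¬ Zero (Q.map (P l))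
    QP≢0 l h = x-off l (∥-sym (P≢0 l) (Q.kernel h))

    Hits : Fin (q ℕ.* q ℕ.+ suc q) → Fin (suc (suc k)) → Set (c ⊔ ℓ)
    Hits y l = πᵖ.point y ∥ Q.map (P l)

    hits-unique : ∀ {y y′ l} → Hits y l → Hits y′ l → y ≡ y′
    hits-unique {y′ = y′} h h′ = πᵖ.point-distinct (∥-trans h (∥-sym (πᵖ.point≢0 y′) h′))

    hits? : ∀ y → Dec (∃ (Hits y))
    hits? y = Fin.any? (λ l → πᵖ.point y ∥? Q.map (P l))

    -- Every line through x meeting the cap is a secant, so fewer than q² + q + 1 of them do.
    not-all-hit : ¬ (∀ y → ∃ (Hits y))
    not-all-hit all = contradiction (bounded too-many) (≡.subst (λ r → ¬ suc (suc r) ≤ suc (suc k)) k≡ ℕ.1+n≰n)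
      where
      h : Fin (q ℕ.* q ℕ.+ suc q) → Fin (suc (suc k))
      h y = proj₁ (all y)
      partner : ∀ y → ∃ λ m → m ≢ h y × Hits y m
      partner y = let (m , m≢ , m∈) = complete⇒secant k≡ K (h y) x (x-off (h y)) in
        m , m≢ , ∥-trans (proj₂ (all y)) (∥-sym (QP≢0 m) (∈-Zero (∈-comm (Q.map-∈ m∈)) Q.vanishes))
      -- One point on each line already makes q^2 + q + 1, one less than the cap has; the second
      -- points on two of the lines exceed its size.
      two : Distinct {k = q ℕ.* q ℕ.+ suc q} 2 (λ _ → ⊤)
      two = take (≡.subst (2 ≤_) k≡ 2≤) everything
        where
        2≤ : 2 ≤ suc k
        2≤ = ≡.subst (2 ≤_) (≡.sym k≡) (ℕ.≤-trans (s≤s 1≤q) (ℕ.m≤n+m (suc q) (q ℕ.* q)))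
          where
          1≤q : 1 ≤ q
          1≤q = ℕ.≤-trans (s≤s z≤n) (Fin.toℕ<n (index 0#))
      y₀ = to two zero
      y₁ = to two (suc zero)
      base : Distinct (q ℕ.* q ℕ.+ suc q) (λ (_ : Fin (suc (suc k))) → ⊤)
      base = record { to = h ; to-injective = λ {y} {y′} eq → hits-unique (≡.subst (Hits y) eq (proj₂ (all y))) (proj₂ (all y′)) ; holds = λ _ → tt }
      ∉base : ∀ y y′ → h y′ ≢ proj₁ (partner y)
      ∉base y y′ eq = proj₁ (proj₂ (partner y)) (≡.trans (≡.sym eq)
        (≡.cong h (hits-unique (≡.subst (Hits y′) eq (proj₂ (all y′))) (proj₂ (proj₂ (partner y))))))
      too-many : Distinct (suc (suc (q ℕ.* q ℕ.+ suc q))) (λ (_ : Fin (suc (suc k))) → ⊤)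
      too-many = extend (extend base (proj₁ (partner y₀)) tt (∉base y₀)) (proj₁ (partner y₁)) tt λ
        { zero eq → case to-injective two {zero} {suc zero} (hits-unique (proj₂ (proj₂ (partner y₀)))
            (≡.subst (Hits y₁) (≡.sym eq) (proj₂ (proj₂ (partner y₁))))) of λ ()
        ; (suc y) → ∉base y₁ y }

    some-line-missed : ∃ λ y → ∀ l → ¬ Hits y l
    some-line-missed = let (y , h) = Fin.¬∀⟶∃¬ _ _ hits? not-all-hit in y , λ l p → h (l , p)

    t : Vector 4
    t = proj₁ (Q.lift (πᵖ.point (proj₁ some-line-missed)))
    Qt : Q.map t ≐ πᵖ.point (proj₁ some-line-missed)
    Qt = proj₂ (Q.lift (πᵖ.point (proj₁ some-line-missed)))

    t∦x : ¬ t ∥ x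
    t∦x t∥x = πᵖ.point≢0 _ λ j → trans (sym (Qt j)) (∥-Zero (Q.map-∥ t∥x) Q.vanishes j)

    φ : Pencil x t
    φ = pencil x t x≢0 t∦x
    private module φ = Pencil φ

    -- A cap point on the line `x t` would project from `x` to the point that no cap point hits.
    external : ∀ l → ¬ Zero (φ.map (P l))
    external l h = proj₂ some-line-missed l (∥-sym (QP≢0 l)
      (∥-trans (∈-Zero (∈-comm (Q.map-∈ (φ.kernel h))) Q.vanishes) (1# , λ j → trans (Qt j) (sym (*-identityˡ _)))))

    class : Fin (suc (suc k)) → Fin (suc q)
    class l = proj₁ (ℓᵖ.locate (φ.map (P l)) (external l))
    in-class : ∀ l → φ.map (P l) ∥ ℓᵖ.point (class l)
    in-class l = proj₂ (ℓᵖ.locate (φ.map (P l)) (external l))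

    plane-of : Fin (suc q) → Plane
    plane-of y = pencil-plane φ (ℓᵖ.point y) (ℓᵖ.point≢0 y)

    class⇒on : ∀ {y l} → class l ≡ y → On (plane-of y) l
    class⇒on {y} {l} eq = ∥⇒det≈0 {ℓᵖ.point y} {φ.map (P l)} (≡.subst (λ y → φ.map (P l) ∥ ℓᵖ.point y) eq (in-class l))

    on⇒class : ∀ {y l} → On (plane-of y) l → class l ≡ y
    on⇒class {y} {l} l∈ = ℓᵖ.point-distinct (∥-trans (∥-sym (external l) (in-class l))
      (det≈0⇒∥ {ℓᵖ.point y} {φ.map (P l)} (ℓᵖ.point≢0 y) l∈))

    -- A nonempty section smaller than q + 2 would leave a line through one of its points without a
    -- second cap point, that is, a tangent.
    class-size : ∀ {y r} (d : Distinct r (λ l → class l ≡ y)) → Exhaustive d → suc (suc q) ∣ r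
    class-size {r = zero} d exh = _ ∣0
    class-size {y} {suc r} d exh = ≡.subst (suc (suc q) ∣_) (≡.cong suc (ℕ.≤-antisym
      (ℕ.≮⇒≥ not-less) (ℕ.s≤s⁻¹ (plane-size K π (map-holds (λ _ → class⇒on) d))))) ∣-refl
      where
      π = plane-of y
      l = to d zero
      l∈ : On π l
      l∈ = class⇒on (holds d zero)
      module V = View (view π (P l) (P≢0 l) l∈)
      rest : Distinct r (λ i → class i ≡ y × i ≢ l)
      rest = remove d zero
      not-less : ¬ r < suc q
      not-less r<1+q =
        let (i , missed) = ℓᵖ.missed-point (V.map ∘ P ∘ to rest) r<1+q
            (e , e∈ , Ve) = V.lift (ℓᵖ.point i)
            e∦l = λ e∥l → ℓᵖ.point≢0 i λ j → trans (sym (Ve j)) (∥-Zero (V.map-∥ e∥l) V.vanishes j)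
            (m , m≢l , m∈) = complete⇒secant k≡ K l e e∦l
            m-on = Plane.span∈ π m∈ e∈ l∈
            (j , eq) = remove-exhaustive d zero exh m (on⇒class m-on , m≢l)
            VPm∥i = ∥-trans (∈-Zero (V.map-∈ m∈) V.vanishes) (1# , λ j → trans (Ve j) (sym (*-identityˡ _)))
        in missed j (≡.subst (λ m → ℓᵖ.point i ∥ V.map (P m)) (≡.sym eq)
             (∥-sym (λ h → nonparallel (m≢l ∘ ≡.sym) (V.kernel m-on h)) VPm∥i))

    divides-size : suc (suc q) ∣ suc (suc k)
    divides-size = ≡.subst (suc (suc q) ∣_) (sumℕ-multiplicity class)
      (sumℕ-∣ (fibre-size class) λ y → class-size (proj₁ (fibre class y)) (proj₂ (fibre class y)))

    impossible : ¬ 2 < q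
    impossible 2<q = contradiction divides-size (indivisible q 2<q k≡)
      where
      -- With q = r + 1 the size is (q + 2)(q - 1) + 4, so q + 2 would divide 4.
      indivisible : ∀ q → 2 < q → suc k ≡ q ℕ.* q ℕ.+ suc q → ¬ suc (suc q) ∣ suc (suc k)
      indivisible (suc r) (s≤s 2≤r) eq div = ℕ.<⇒≱ (s≤s (s≤s (s≤s 2≤r)))
        (∣⇒≤ (∣m+n∣m⇒∣n (≡.subst (suc (suc (suc r)) ∣_) (≡.trans (≡.cong suc eq) (expand r)) div) (m∣m*n r)))
        where
        open import Data.Nat.Solver using (module +-*-Solver)
        module S = +-*-Solver
        expand : ∀ r → suc (suc r ℕ.* suc r ℕ.+ suc (suc r)) ≡ suc (suc (suc r)) ℕ.* r ℕ.+ 4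
        expand = S.solve 1 (λ r → S.con 1 S.:+ ((S.con 1 S.:+ r) S.:* (S.con 1 S.:+ r) S.:+ (S.con 2 S.:+ r))
                                  S.:= (S.con 3 S.:+ r) S.:* r S.:+ S.con 4) ≡.refl

  -- `gap` counts the points missing up to q^2 + q + 2; each enlargement lowers it by one, until no
  -- tangent is left.
  no-large-cap : 2 < q → ∀ gap {k} → suc k ℕ.+ gap ≡ q ℕ.* q ℕ.+ suc q → q ℕ.* q ≤ k → ¬ CapSet (suc (suc k))
  no-large-cap 2<q zero eq q²≤k K = Complete.impossible (≡.trans (≡.sym (ℕ.+-identityʳ _)) eq) K 2<q
  no-large-cap 2<q (suc gap) {k} eq q²≤k K = no-large-cap 2<q gap (≡.trans (≡.sym (ℕ.+-suc (suc k) gap)) eq) (ℕ.m≤n⇒m≤1+n q²≤k)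
    (Enlarge.enlarged (ℕ.≤-trans (s≤s z≤n) 2<q) q²≤k
      (≡.subst (suc k <_) eq (ℕ.≤-trans (ℕ.≤-reflexive (ℕ.+-comm 1 (suc k))) (ℕ.+-monoʳ-≤ (suc k) (s≤s z≤n)))) K)

  ovoid-bound : 2 < q → ∀ {n} → CapSet n → n ≤ q ℕ.* q ℕ.+ 1
  ovoid-bound 2<q {n} K with n ℕ.≤? q ℕ.* q ℕ.+ 1
  ... | yes n≤ = n≤
  ovoid-bound 2<q {zero} K | no n≰ = z≤n
  ovoid-bound 2<q {suc zero} K | no n≰ = ℕ.m≤n+m 1 (q ℕ.* q)
  ovoid-bound 2<q {suc (suc k)} K | no n≰ = contradiction K
    (no-large-cap 2<q (q ℕ.* q ℕ.+ suc q ℕ.∸ suc k) (ℕ.m+[n∸m]≡n (cap-size K))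
      (ℕ.s≤s⁻¹ (ℕ.s≤s⁻¹ (≡.subst (_< suc (suc k)) (ℕ.+-comm (q ℕ.* q) 1) (ℕ.≰⇒> n≰)))))

  binary-bound : q ≡ 2 → ∀ {n} → CapSet n → n ≤ 8
  binary-bound q≡2 {zero} K = z≤n
  binary-bound ≡.refl {suc n} K = s≤s (cap-size K)

  fromCap : ∀ {n} → Cap n → CapSet n
  fromCap {n} (P , P≢0 , pairs , triples) = record { P = P ; P≢0 = P≢0 ; no-three = λ {i} {j} {l} → three i j l }
    where
    -1≉0 : ¬ (- 1# ≈ 0#)
    -1≉0 h = 0≉1 (sym (trans (solve 0 (:1 := :- (:- :1)) refl) (trans (-‿cong h) (solve 0 (:- :0 := :0) refl))))
    three : ∀ i j l → i ≢ l → j ≢ l → ¬ P l ∈⟨ P i , P j ⟩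
    three i j l i≢l j≢l (a , b , h) with i Fin.≟ j
    ... | no i≢j = -1≉0 (triples i j l i≢j j≢l i≢l (a VF.∷ b VF.∷ - 1# VF.∷ VF.[]) (λ m →
      trans (+-congˡ (+-congˡ (+-congʳ (*-congˡ (h m)))))
        (solve 4 (λ a b x y → a :* x :+ (b :* y :+ (:- :1 :* (a :* x :+ b :* y) :+ :0)) := :0) refl a b (P i m) (P j m))) (suc (suc zero)))
    ... | yes ≡.refl = -1≉0 (pairs i l i≢l ((a + b) VF.∷ - 1# VF.∷ VF.[]) (λ m →
      trans (+-congˡ (+-congʳ (*-congˡ (h m))))
        (solve 3 (λ a b x → (a :+ b) :* x :+ (:- :1 :* (a :* x :+ b :* x) :+ :0) := :0) refl a b (P i m))) (suc zero))

open import Data.Nat using (_+_; _*_)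

theorem4p24 : ∀ {c ℓ p} (F : Field c ℓ) → let open LinearAlgebra F in
    (n t : ℕ) → 2 ≤ n → 2 * (t + 4) ≡ n * suc n →
    (C : Mat n → Set p) → Code n t 4 C →
    Cap n ×
    ((q : ℕ) → HasCardinality q →
    (q ≡ 2 → n ≤ 8) × (2 < q → n ≤ q * q + 1))
theorem4p24 F 1 t (s≤s ()) dim C code
-- The dimension equation would read 2(t + 4) = 6.
theorem4p24 F 2 t 2≤n dim C code = contradiction
  (ℕ.≤-trans (ℕ.*-monoʳ-≤ 2 (ℕ.m≤n+m 4 t)) (ℕ.≤-reflexive dim)) (ℕ.m+1+n≰m 6 {1})
theorem4p24 F (suc (suc (suc m))) t 2≤n dim C code =
  cap , λ q card → let open CapBounds F card in
    (λ q≡2 → binary-bound q≡2 (fromCap cap)) , λ 2<q → ovoid-bound 2<q (fromCap cap)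
  where
  cap : LinearAlgebra.Cap F (suc (suc (suc m)))
  cap = CapFromCode.isCap F dim code
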